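{- Let $n \ge 3$ and let $q \in \mathbb{C}\setminus\{0\}$ with $q \notin \{ -1,1\}$. Then there is no linear transformation $\varphi : \mathbb{C}^{n\times n} \to \mathbb{C}^{n\times n}$ such that $\mathrm{P}_q(X) = \det(\varphi(X))$ for all $X \in \mathbb{C}^{n\times n}$, and there is no linear transformation $\varphi : \mathbb{C}^{n\times n} \to \mathbb{C}^{n\times n}$ such that $\mathrm{P}_q(X) = \operatorname{per}(\varphi(X))$ for all $X \in \mathbb{C}^{n\times n}$.
   Context: For $q \in \mathbb{C}\setminus\{0\}$ and $A = [a_{i,j}] \in \mathbb{C}^{n\times n}$, the $q$-permanent is $\mathrm{P}_q(A) = \sum_{\sigma \in \mathfrak{S}_n} q^{\ell(\sigma)} \prod_{i=1}^n a_{i,\sigma(i)}$, where $\mathfrak{S}_n$ is the symmetric group and $\ell(\sigma) = \#\{(i,j) : i<j,\ \sigma(i)>\sigma(j)\}$ is the number of inversions of $\sigma$. Thus $\mathrm{P}_1 = \operatorname{per}$ and $\mathrm{P}_{ -1} = \det$. -}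

module Defs where

open import Level using (Level; _⊔_)
open import Algebra.Bundles using (CommutativeRing; Semiring)
import Algebra.Definitions.RawSemiring as RawSemiringDefs
open import Data.Nat as ℕ using (ℕ; zero; suc)
open import Data.Fin as Fin using (Fin; zero; suc)
open import Data.Fin.Properties using () renaming (_≟_ to _≟ᶠ_)
open import Data.List as List using (List; []; _∷_; allFin; map; concatMap; foldr; length; filterᵇ)
open import Data.Bool using (Bool; true; false; _∧_; _∨_; not)
open import Data.Product using (Σ; ∃; _×_; _,_)
open import Relation.Nullary using (¬_; does)

allFunctions : (m k : ℕ) → List (Fin m → Fin k)
allFunctions zero    k = (λ ()) ∷ []
allFunctions (suc m) k =
  concatMap (λ a → map (λ f → λ { zero → a ; (suc i) → f i }) (allFunctions m k))
            (allFin k)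

allᵇ : ∀ {a} {A : Set a} → (A → Bool) → List A → Bool
allᵇ p = foldr (λ x b → p x ∧ b) true

isInjectiveᵇ : ∀ {n} → (Fin n → Fin n) → Bool
isInjectiveᵇ {n} σ =
  allᵇ (λ i → allᵇ (λ j → not (does (σ i ≟ᶠ σ j)) ∨ does (i ≟ᶠ j)) (allFin n)) (allFin n)

-- The symmetric group 𝔖ₙ, as the list of all bijections Fin n → Fin n
-- (an endomap of a finite set is a bijection iff it is injective)
permutations : (n : ℕ) → List (Fin n → Fin n)
permutations n = filterᵇ isInjectiveᵇ (allFunctions n n)

inversions : ∀ {n} → (Fin n → Fin n) → ℕ
inversions {n} σ =
  length (filterᵇ (λ p → isInv (Data.Product.proj₁ p) (Data.Product.proj₂ p))
                  (List.cartesianProduct (allFin n) (allFin n)))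
  where
  isInv : Fin n → Fin n → Bool
  isInv i j = does (i Fin.<? j) ∧ does (σ j Fin.<? σ i)

module Over {c ℓ : Level} (R : CommutativeRing c ℓ) where
  open CommutativeRing R renaming (Carrier to K)
  open RawSemiringDefs (Semiring.rawSemiring semiring) using (_^_) renaming (_×_ to _·ₙ_)

  Matrix : ℕ → Set c
  Matrix n = Fin n → Fin n → K

  ∑ : List K → K
  ∑ = foldr _+_ 0#

  ∏ : ∀ {n} → (Fin n → K) → K
  ∏ {n} f = foldr _*_ 1# (map f (allFin n))

  qPer : K → ∀ {n} → Matrix n → K
  qPer q {n} A = ∑ (map (λ σ → (q ^ inversions σ) * ∏ (λ i → A i (σ i))) (permutations n))

  det : ∀ {n} → Matrix n → K
  det = qPer (- 1#)

  per : ∀ {n} → Matrix n → K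
  per = qPer 1#

  record IsLinear {n : ℕ} (φ : Matrix n → Matrix n) : Set (c ⊔ ℓ) where
    field
      cong  : ∀ X Y → (∀ i j → X i j ≈ Y i j) → ∀ i j → φ X i j ≈ φ Y i j
      additive : ∀ X Y i j → φ (λ k l → X k l + Y k l) i j ≈ φ X i j + φ Y i j
      homogeneous : ∀ (a : K) X i j → φ (λ k l → a * X k l) i j ≈ a * φ X i j

  IsField : Set (c ⊔ ℓ)
  IsField = (¬ (1# ≈ 0#)) × (∀ x → ¬ (x ≈ 0#) → ∃ λ y → x * y ≈ 1#)

  CharZero : Set ℓ
  CharZero = ∀ (m : ℕ) → ¬ (suc m ·ₙ 1# ≈ 0#)

  AlgebraicallyClosed : Set (c ⊔ ℓ)
  AlgebraicallyClosed =
    ∀ (d : ℕ) (a : Fin (suc d) → K) →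
      ∃ λ x → (x ^ suc d) + ∑ (map (λ i → a i * (x ^ Fin.toℕ i)) (allFin (suc d))) ≈ 0#

-- An algebraically closed field of characteristic 0 (e.g. ℂ)
record ACF₀ (c ℓ : Level) : Set (Level.suc (c ⊔ ℓ)) where
  field
    ring : CommutativeRing c ℓ
  open Over ring
  field
    isField : IsField
    charZero : CharZero
    algClosed : AlgebraicallyClosed

{-# OPTIONS --safe #-}
module Submission where

-- Call a matrix Y flat for a form F if F is of degree at most one in the direction Y at every point.
-- Matrices supported on a single row or column are flat for every q-permanent.  For q ≠ -1 there is
-- not much more: the weights q^ℓ(σ) of the three even and of the three odd rearrangements of a
-- permutation at three rows have products differing by exactly one factor q, and this excludes flat
-- matrices with a full 2 × 3 or 3 × 2 minor, so that a flat matrix lives on a line or on a 2 × 2 block.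
-- If P_q = P_s ∘ φ with φ linear, then φ is invertible, and its inverse maps the n-dimensional spaces
-- of matrices on a line, which are flat for P_s, to spaces flat for P_q, hence to lines since n ≥ 3.
-- So φ is monomial up to transposition.  The ratio of the even and odd weights at three rows is
-- unaffected by rescaling the entries, and it is q^±1 for P_q and s for P_s with s = ±1; hence q = s.

open import Defs
open import Level using (Level; _⊔_)
open import Algebra.Bundles using (CommutativeRing; CommutativeMonoid)
import Algebra.Properties.CommutativeMonoid.Sum as MonoidSum
import Algebra.Properties.Ring as RingProperties
import Algebra.Properties.Semiring.Exp as Exp
import Algebra.Properties.Semiring.Mult as Mult
import Algebra.Properties.Semiring.Sum as SemiringSum
import Algebra.Solver.Ring.NaturalCoefficients.Default as SemiringSolver
import Relation.Binary.Reasoning.Setoid as SetoidReasoning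
open import Data.Bool using (Bool; true; false; _∧_; _∨_; not; if_then_else_; T)
open import Data.Bool.Properties using (T-∧; T-∨)
open import Data.Empty using (⊥; ⊥-elim)
open import Data.Fin as Fin using (Fin; zero; suc; punchIn; punchOut; combine; remQuot)
open import Data.Fin.Patterns
open import Data.Fin.Permutation.Components using (transpose; transpose-inverse)
open import Data.Fin.Properties using (_≟_; any?; all?; <-cmp; <-trans; <-irrefl; <-asym; injective⇒≤; punchInᵢ≢i; punchIn-punchOut; punchOut-injective; punchOut-cong; punchOut-punchIn; ¬∀⟶∃¬; remQuot-combine; combine-remQuot)
open import Data.List as List using (List; []; _∷_; _++_; map; concatMap; filterᵇ; length; cartesianProduct; tabulate; allFin)
open import Data.Nat as ℕ using (ℕ; zero; suc; _≤_; _<_; z≤n; s≤s; _≡ᵇ_)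
import Data.Nat.Properties as ℕₚ
open import Data.Nat.Solver using (module +-*-Solver)
open import Data.Product using (∃; _×_; _,_; proj₁; proj₂; uncurry)
open import Data.Sum using (_⊎_; inj₁; inj₂)
open import Data.Unit using (tt)
open import Data.Vec.Functional as Vector using (insertAt)
open import Data.Vec.Functional.Properties using (insertAt-lookup; insertAt-punchIn)
open import Function using (_∘_; id; case_of_)
open import Function.Bundles using (Equivalence)
open import Function.Definitions using (Injective)
open import Relation.Binary.Definitions using (tri<; tri≈; tri>)
open import Relation.Binary.PropositionalEquality as ≡ using (_≡_; _≢_; _≗_)
open import Relation.Nullary using (¬_; Dec; yes; no; does; contradiction; ¬?)
open import Relation.Nullary.Decidable using (dec-true; dec-false; decidable-stable; ¬¬-excluded-middle; _×-dec_)

-- The determinant has far more flat matrices than lines and blocks: every matrix of rank one is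
-- flat for it. Flatness is therefore classified for P_q only, and of P_s only the flatness of lines
-- is used. This is why spaces are carried along the inverse of φ, and why s = -1 and s = 1 are
-- treated together. φ is injective because P_q does not change along a matrix in its kernel, and
-- such a matrix must be zero. A 2 × 2 block cannot be excluded for a single flat matrix, only for a
-- space of dimension at least three. A whole space is reduced to one matrix by taking a generic
-- member, whose support is that of the space. The forms are functions here, not polynomials. A
-- coefficient is extracted by freezing rows, which amounts to taking differences of an identity
-- that holds at every base point. Equality in K is not decidable. Pivots, supports and preimages
-- are found under double negation, which costs nothing since the goal is a negation.

module ℕSum = MonoidSum ℕₚ.+-0-commutativeMonoid

-- Permutations, and inversions of rearrangements at three rows.

module Permutations where
  open import Data.Nat using (_+_)
  open ≡ using (refl; sym; trans; cong; cong₂; subst)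


  Inj : ∀ {n} → (Fin n → Fin n) → Set
  Inj = Injective _≡_ _≡_

  -- Punching out a missed value would leave an injection into a smaller set.
  injective⇒surjective : ∀ {n} {f : Fin n → Fin n} → Inj f → ∀ y → ∃ λ x → f x ≡ y
  injective⇒surjective {suc n} {f} inj y with any? (λ x → f x ≟ y)
  ... | yes hit  = hit
  ... | no  miss = contradiction (injective⇒≤ {f = λ x → punchOut (y≢f x)} λ eq → inj (punchOut-injective (y≢f _) (y≢f _) eq)) ℕₚ.1+n≰n
    where
    y≢f : ∀ x → y ≢ f x
    y≢f x eq = miss (x , sym eq)

  transpose-left : ∀ {n} (i j : Fin n) → transpose i j i ≡ j
  transpose-left i j rewrite dec-true (i ≟ i) refl = refl

  transpose-right : ∀ {n} (i j : Fin n) → transpose i j j ≡ i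
  transpose-right i j with j ≟ i
  ... | yes j≡i = j≡i
  ... | no _ rewrite dec-true (j ≟ j) refl = refl

  transpose-other : ∀ {n} (i j : Fin n) {k} → k ≢ i → k ≢ j → transpose i j k ≡ k
  transpose-other i j {k} k≢i k≢j rewrite dec-false (k ≟ i) k≢i | dec-false (k ≟ j) k≢j = refl

  transpose-injective : ∀ {n} (i j : Fin n) → Inj (transpose i j)
  transpose-injective i j {x} {y} eq = trans (sym (transpose-inverse j i)) (trans (cong (transpose j i) eq) (transpose-inverse j i))

  -- Swapping the values `σ a` and `x` disturbs no other value, so prescribed values can be imposed
  -- one after another.
  redirect : ∀ {n} {σ : Fin n → Fin n} → Inj σ → ∀ a x →
             ∃ λ τ → Inj τ × τ a ≡ x × (∀ b → b ≢ a → σ b ≢ x → τ b ≡ σ b)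
  redirect {σ = σ} inj a x =
    transpose (σ a) x ∘ σ ,
    (λ eq → inj (transpose-injective (σ a) x eq)) ,
    transpose-left (σ a) x ,
    λ b b≢a → transpose-other (σ a) x (b≢a ∘ inj)

  injection-through₂ : ∀ {n} {a b x y : Fin n} → a ≢ b → x ≢ y →
                       ∃ λ σ → Inj σ × σ a ≡ x × σ b ≡ y
  injection-through₂ {a = a} {b} {x} {y} a≢b x≢y
    with redirect {σ = id} id a x
  ... | σ , inj , σa , _ with redirect inj b y
  ... | τ , inj′ , τb , rest = τ , inj′ , trans (rest a a≢b (λ eq → x≢y (trans (sym σa) eq))) σa , τb

  injection-through₃ : ∀ {n} {a b c x y z : Fin n} → a ≢ b → a ≢ c → b ≢ c → x ≢ y → x ≢ z → y ≢ z →
                       ∃ λ σ → Inj σ × σ a ≡ x × σ b ≡ y × σ c ≡ z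
  injection-through₃ {a = a} {b} {c} {x} {y} {z} a≢b a≢c b≢c x≢y x≢z y≢z
    with injection-through₂ a≢b x≢y
  ... | σ , inj , σa , σb with redirect inj c z
  ... | τ , inj′ , τc , rest =
    τ , inj′ , trans (rest a a≢c (λ eq → x≢z (trans (sym σa) eq))) σa
             , trans (rest b b≢c (λ eq → y≢z (trans (sym σb) eq))) σb , τc

  -- `σ` is only a reference away from `a`, `b`, `c`. Stating values pointwise makes rearrangements
  -- comparable however they were composed.
  record Rearranges {n} (σ : Fin n → Fin n) (a b c x y z : Fin n) (τ : Fin n → Fin n) : Set where
    constructor rearranges
    field
      at₁ : τ a ≡ x
      at₂ : τ b ≡ y
      at₃ : τ c ≡ z
      off : ∀ s → s ≢ a → s ≢ b → s ≢ c → τ s ≡ σ s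

  -- The six rearrangements of the values x, y, z of σ at a, b, c: even ones e, odd ones o.
  record Hexagon {n} (a b c x y z : Fin n) (e₀ e₁ e₂ o₀ o₁ o₂ : Fin n → Fin n) : Set where
    field
      a≢b : a ≢ b
      a≢c : a ≢ c
      b≢c : b ≢ c
      x≢y : x ≢ y
      x≢z : x ≢ z
      y≢z : y ≢ z
      E₀ : Rearranges e₀ a b c x y z e₀
      E₁ : Rearranges e₀ a b c y z x e₁
      E₂ : Rearranges e₀ a b c z x y e₂
      O₀ : Rearranges e₀ a b c y x z o₀
      O₁ : Rearranges e₀ a b c x z y o₁
      O₂ : Rearranges e₀ a b c z y x o₂

  bit : Bool → ℕ
  bit b = if b then 1 else 0

  -- The values `u`, `v` are arguments of their own, so that one of them can vary while the other
  -- stays fixed.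
  inverted : ∀ {n} → Fin n → Fin n → Fin n → Fin n → ℕ
  inverted i j u v = bit (does (i Fin.<? j) ∧ does (v Fin.<? u))

  length-filter-++ : ∀ {A : Set} (p : A → Bool) xs ys →
    length (filterᵇ p (xs ++ ys)) ≡ length (filterᵇ p xs) + length (filterᵇ p ys)
  length-filter-++ p []       ys = refl
  length-filter-++ p (x ∷ xs) ys with p x
  ... | true  = cong suc (length-filter-++ p xs ys)
  ... | false = length-filter-++ p xs ys

  length-filter-tabulate : ∀ {A B : Set} (p : B → Bool) (h : A → B) {n} (f : Fin n → A) →
    length (filterᵇ p (List.map h (tabulate f))) ≡ ℕSum.sum (λ i → bit (p (h (f i))))
  length-filter-tabulate p h {zero}  f = refl
  length-filter-tabulate p h {suc n} f with p (h (f zero))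
  ... | true  = cong suc (length-filter-tabulate p h (f ∘ suc))
  ... | false = length-filter-tabulate p h (f ∘ suc)

  length-filter-product : ∀ {A B : Set} (p : A × B → Bool) {m n} (f : Fin m → A) (g : Fin n → B) →
    length (filterᵇ p (cartesianProduct (tabulate f) (tabulate g))) ≡
    ℕSum.sum (λ i → ℕSum.sum (λ j → bit (p (f i , g j))))
  length-filter-product p {zero}  f g = refl
  length-filter-product p {suc m} f g =
    trans (length-filter-++ p (List.map (f zero ,_) (tabulate g)) _)
          (cong₂ _+_ (length-filter-tabulate p (f zero ,_) g) (length-filter-product p (f ∘ suc) g))

  inversions-sum : ∀ {n} (σ : Fin n → Fin n) →
    inversions σ ≡ ℕSum.sum (λ i → ℕSum.sum (λ j → inverted i j (σ i) (σ j)))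
  inversions-sum {n} σ =
    length-filter-product (λ (i , j) → does (i Fin.<? j) ∧ does (σ j Fin.<? σ i)) {n} {n} id id

  inversions-cong : ∀ {n} {σ τ : Fin n → Fin n} → σ ≗ τ → inversions σ ≡ inversions τ
  inversions-cong {σ = σ} {τ} σ≗τ =
    trans (inversions-sum σ)
   (trans (ℕSum.sum-cong-≗ λ i → ℕSum.sum-cong-≗ λ j → cong₂ (inverted i j) (σ≗τ i) (σ≗τ j))
          (sym (inversions-sum τ)))

  -- The two sums differ by what their terms at `a` differ. Additions on both sides avoid the
  -- truncated subtraction of naturals.
  sum-differ₁ : ∀ {n} (a : Fin n) {F G : Fin n → ℕ} → (∀ i → i ≢ a → F i ≡ G i) →
                ℕSum.sum F + G a ≡ ℕSum.sum G + F a
  sum-differ₁ {suc n} a {F} {G} agree = begin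
    ℕSum.sum F + G a           ≡⟨ cong (_+ G a) (ℕSum.sum-remove {i = a} F) ⟩
    F a + _ + G a              ≡⟨ cong (λ t → F a + t + G a) (ℕSum.sum-cong-≗ λ i → agree (punchIn a i) (punchInᵢ≢i a i)) ⟩
    F a + rest + G a           ≡⟨ solve 3 (λ f r g → f :+ r :+ g := g :+ r :+ f) refl (F a) rest (G a) ⟩
    G a + rest + F a           ≡⟨ cong (_+ F a) (ℕSum.sum-remove {i = a} G) ⟨
    ℕSum.sum G + F a           ∎
    where
    open ≡.≡-Reasoning
    open +-*-Solver
    rest = ℕSum.sum (λ i → G (punchIn a i))

  sum-differ₃ : ∀ {n} {a b c : Fin n} → a ≢ b → a ≢ c → b ≢ c → {F G : Fin n → ℕ} →
                (∀ i → i ≢ a → i ≢ b → i ≢ c → F i ≡ G i) →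
                ℕSum.sum F + (G a + G b + G c) ≡ ℕSum.sum G + (F a + F b + F c)
  sum-differ₃ {a = a} {b} {c} a≢b a≢c b≢c {F} {G} agree =
    assemble (ℕSum.sum F) (ℕSum.sum F₁) (ℕSum.sum F₂) (ℕSum.sum G) (F a) (F b) (F c) (G a) (G b) (G c)
      (subst (λ t → ℕSum.sum F + t ≡ ℕSum.sum F₁ + F a) F₁a (sum-differ₁ a {F} {F₁} F~F₁))
      (≡.subst₂ (λ t u → ℕSum.sum F₁ + t ≡ ℕSum.sum F₂ + u) F₂b F₁b (sum-differ₁ b {F₁} {F₂} F₁~F₂))
      (subst (λ t → ℕSum.sum F₂ + G c ≡ ℕSum.sum G + t) F₂c (sum-differ₁ c {F₂} {G} F₂~G))
    where
    -- Interpolation from `F` to `G`: `F₁` is already `G` at `a`, `F₂` at `a` and `b`, so each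
    -- passage changes a single term.
    F₁ = λ i → if does (i ≟ a) then G i else F i
    F₂ = λ i → if does (i ≟ b) then G i else F₁ i
    F₁a : F₁ a ≡ G a
    F₁a rewrite dec-true (a ≟ a) refl = refl
    F₁b : F₁ b ≡ F b
    F₁b rewrite dec-false (b ≟ a) (a≢b ∘ sym) = refl
    F₂b : F₂ b ≡ G b
    F₂b rewrite dec-true (b ≟ b) refl = refl
    F₂c : F₂ c ≡ F c
    F₂c rewrite dec-false (c ≟ b) (b≢c ∘ sym) | dec-false (c ≟ a) (a≢c ∘ sym) = refl
    F~F₁ : ∀ i → i ≢ a → F i ≡ F₁ i
    F~F₁ i i≢a rewrite dec-false (i ≟ a) i≢a = refl
    F₁~F₂ : ∀ i → i ≢ b → F₁ i ≡ F₂ i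
    F₁~F₂ i i≢b rewrite dec-false (i ≟ b) i≢b = refl
    F₂~G : ∀ i → i ≢ c → F₂ i ≡ G i
    F₂~G i i≢c with i ≟ b
    ... | yes _ = refl
    ... | no i≢b with i ≟ a
    ... | yes _ = refl
    ... | no i≢a = agree i i≢a i≢b i≢c
    assemble : ∀ s s₁ s₂ t fa fb fc ga gb gc → s + ga ≡ s₁ + fa → s₁ + gb ≡ s₂ + fb → s₂ + gc ≡ t + fc →
              s + (ga + gb + gc) ≡ t + (fa + fb + fc)
    assemble s s₁ s₂ t fa fb fc ga gb gc p q r = begin
      s + (ga + gb + gc)   ≡⟨ solve 4 (λ s a b c → s :+ (a :+ b :+ c) := s :+ a :+ (b :+ c)) refl s ga gb gc ⟩
      s + ga + (gb + gc)   ≡⟨ cong (_+ (gb + gc)) p ⟩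
      s₁ + fa + (gb + gc)  ≡⟨ solve 4 (λ s a b c → s :+ a :+ (b :+ c) := s :+ b :+ (a :+ c)) refl s₁ fa gb gc ⟩
      s₁ + gb + (fa + gc)  ≡⟨ cong (_+ (fa + gc)) q ⟩
      s₂ + fb + (fa + gc)  ≡⟨ solve 4 (λ s b a c → s :+ b :+ (a :+ c) := s :+ c :+ (a :+ b)) refl s₂ fb fa gc ⟩
      s₂ + gc + (fa + fb)  ≡⟨ cong (_+ (fa + fb)) r ⟩
      t + fc + (fa + fb)   ≡⟨ solve 4 (λ t c a b → t :+ c :+ (a :+ b) := t :+ (a :+ b :+ c)) refl t fc fa fb ⟩
      t + (fa + fb + fc)   ∎
      where
      open ≡.≡-Reasoning
      open +-*-Solver

  threeByThree : (Fin 3 → Fin 3 → ℕ) → ℕ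
  threeByThree g = (g 0F 0F + g 0F 1F + g 0F 2F) + (g 1F 0F + g 1F 1F + g 1F 2F) + (g 2F 0F + g 2F 1F + g 2F 2F)

  threeByThree-cong : ∀ {g h : Fin 3 → Fin 3 → ℕ} → (∀ i j → g i j ≡ h i j) → threeByThree g ≡ threeByThree h
  threeByThree-cong eq =
    cong₂ _+_ (cong₂ _+_ (row 0F) (row 1F)) (row 2F)
    where row = λ i → cong₂ _+_ (cong₂ _+_ (eq i 0F) (eq i 1F)) (eq i 2F)

  -- The order of three distinct elements u, v, w, encoded by the truth values of u < v, v < w, u < w.
  order : Bool → Bool → Bool → Fin 3 → Fin 3 → Bool
  order p q r 0F 1F = p
  order p q r 1F 0F = not p
  order p q r 1F 2F = q
  order p q r 2F 1F = not q
  order p q r 0F 2F = r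
  order p q r 2F 0F = not r
  order p q r _  _  = false

  -- Of the eight truth assignments six describe orders; the two cyclic ones are excluded.
  transitive : Bool → Bool → Bool → Bool
  transitive true  true  r = r
  transitive false false r = not r
  transitive _     _     _ = true

  arrange : {A : Set} (x y z : A) → Fin 3 → A
  arrange x y z 0F = x
  arrange x y z 1F = y
  arrange x y z 2F = z

  -- Positions within `x`, `y`, `z` of the values taken at the three rows, listed as in `Hexagon`.
  evens odds : Fin 3 → Fin 3 → Fin 3
  evens 0F = arrange 0F 1F 2F
  evens 1F = arrange 1F 2F 0F
  evens 2F = arrange 2F 0F 1F
  odds 0F = arrange 1F 0F 2F
  odds 1F = arrange 0F 2F 1F
  odds 2F = arrange 2F 1F 0F

  countInversions : (κ : Fin 3 → Fin 3 → Fin 3) (R S : Fin 3 → Fin 3 → Bool) → ℕ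
  countInversions κ R S = threeByThree λ i j →
    bit (R i j ∧ S (κ 0F j) (κ 0F i)) + bit (R i j ∧ S (κ 1F j) (κ 1F i)) + bit (R i j ∧ S (κ 2F j) (κ 2F i))

  -- Passes from a test computed at both truth values to a variable. Six nested uses reduce the
  -- claim below to one evaluation over 64 assignments.
  forBoth : (P : Bool → Bool) → T (P true ∧ P false) → ∀ b → T (P b)
  forBoth P t true  = proj₁ (Equivalence.to T-∧ t)
  forBoth P t false = proj₂ (Equivalence.to (T-∧ {P true}) t)

  -- On the 3 × 3 block, the six possible orders of the rows and of the values are checked exhaustively.
  countInversions-differ : ∀ p q r p′ q′ r′ → T (transitive p q r) → T (transitive p′ q′ r′) →
    let E = countInversions evens (order p q r) (order p′ q′ r′)
        O = countInversions odds  (order p q r) (order p′ q′ r′)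
    in  E ≡ suc O ⊎ O ≡ suc E
  countInversions-differ p q r p′ q′ r′ t t′ with Equivalence.to T-∨ (discharge (transitive p q r) (transitive p′ q′ r′) t t′ (checked p q r p′ q′ r′))
    where
    E O : Bool → Bool → Bool → Bool → Bool → Bool → ℕ
    E p q r p′ q′ r′ = countInversions evens (order p q r) (order p′ q′ r′)
    O p q r p′ q′ r′ = countInversions odds  (order p q r) (order p′ q′ r′)
    close : Bool → Bool → Bool → Bool → Bool → Bool → Bool
    close p q r p′ q′ r′ = (E p q r p′ q′ r′ ≡ᵇ suc (O p q r p′ q′ r′)) ∨ (O p q r p′ q′ r′ ≡ᵇ suc (E p q r p′ q′ r′))
    claim : Bool → Bool → Bool → Bool → Bool → Bool → Bool
    claim p q r p′ q′ r′ = not (transitive p q r) ∨ (not (transitive p′ q′ r′) ∨ close p q r p′ q′ r′)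
    all : (Bool → Bool) → Bool
    all P = P true ∧ P false
    checked : ∀ p q r p′ q′ r′ → T (claim p q r p′ q′ r′)
    checked p q r p′ q′ r′ =
      forBoth (claim p q r p′ q′)
     (forBoth (λ q′ → all (claim p q r p′ q′))
     (forBoth (λ p′ → all λ q′ → all (claim p q r p′ q′))
     (forBoth (λ r → all λ p′ → all λ q′ → all (claim p q r p′ q′))
     (forBoth (λ q → all λ r → all λ p′ → all λ q′ → all (claim p q r p′ q′))
     (forBoth (λ p → all λ q → all λ r → all λ p′ → all λ q′ → all (claim p q r p′ q′)) tt p) q) r) p′) q′) r′
    discharge : ∀ a b {c} → T a → T b → T (not a ∨ (not b ∨ c)) → T c
    discharge true true _ _ t = t
  ... | inj₁ e = inj₁ (ℕₚ.≡ᵇ⇒≡ _ _ e)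
  ... | inj₂ e = inj₂ (ℕₚ.≡ᵇ⇒≡ _ _ e)

  module _ {n} {u v w : Fin n} (u≢v : u ≢ v) (u≢w : u ≢ w) (v≢w : v ≢ w) where
    private
      _<ᵇ_ : Fin n → Fin n → Bool
      i <ᵇ j = does (i Fin.<? j)

      flip-< : ∀ {i j : Fin n} → i ≢ j → j <ᵇ i ≡ not (i <ᵇ j)
      flip-< {i} {j} i≢j with <-cmp i j
      ... | tri< i<j _ j≮i rewrite dec-true (i Fin.<? j) i<j = dec-false (j Fin.<? i) j≮i
      ... | tri≈ _ i≡j _ = contradiction i≡j i≢j
      ... | tri> i≮j _ j<i rewrite dec-false (i Fin.<? j) i≮j = dec-true (j Fin.<? i) j<i

      irrefl-< : ∀ (i : Fin n) → i <ᵇ i ≡ false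
      irrefl-< i = dec-false (i Fin.<? i) (<-irrefl refl)

    order-correct : ∀ i j → arrange u v w i <ᵇ arrange u v w j ≡ order (u <ᵇ v) (v <ᵇ w) (u <ᵇ w) i j
    order-correct 0F 0F = irrefl-< u
    order-correct 0F 1F = refl
    order-correct 0F 2F = refl
    order-correct 1F 0F = flip-< u≢v
    order-correct 1F 1F = irrefl-< v
    order-correct 1F 2F = refl
    order-correct 2F 0F = flip-< u≢w
    order-correct 2F 1F = flip-< v≢w
    order-correct 2F 2F = irrefl-< w

    order-transitive : T (transitive (u <ᵇ v) (v <ᵇ w) (u <ᵇ w))
    order-transitive with <-cmp u v | <-cmp v w
    ... | tri≈ _ u≡v _ | _ = contradiction u≡v u≢v
    ... | _ | tri≈ _ v≡w _ = contradiction v≡w v≢w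
    ... | tri< u<v _ _ | tri< v<w _ _
      rewrite dec-true (u Fin.<? v) u<v | dec-true (v Fin.<? w) v<w | dec-true (u Fin.<? w) (<-trans u<v v<w) = tt
    ... | tri> u≮v _ v<u | tri> v≮w _ w<v
      rewrite dec-false (u Fin.<? v) u≮v | dec-false (v Fin.<? w) v≮w
            | dec-false (u Fin.<? w) (<-asym (<-trans w<v v<u)) = tt
    ... | tri< u<v _ _ | tri> v≮w _ _ rewrite dec-true (u Fin.<? v) u<v | dec-false (v Fin.<? w) v≮w = tt
    ... | tri> u≮v _ _ | tri< v<w _ _ rewrite dec-false (u Fin.<? v) u≮v | dec-true (v Fin.<? w) v<w = tt

  -- A pair of rows not both in {a, b, c} is inverted equally often by the even and by the odd arrangements.
  hexagon-inversions : ∀ {n} {a b c x y z : Fin n} {e₀ e₁ e₂ o₀ o₁ o₂} → Hexagon a b c x y z e₀ e₁ e₂ o₀ o₁ o₂ →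
    let E = inversions e₀ + inversions e₁ + inversions e₂
        O = inversions o₀ + inversions o₁ + inversions o₂
    in  E ≡ suc O ⊎ O ≡ suc E
  hexagon-inversions {n} {a} {b} {c} {x} {y} {z} {e₀} {e₁} {e₂} {o₀} {o₁} {o₂} hex = conclude
    where
    open Hexagon hex
    open Rearranges
    open ≡.≡-Reasoning
    open +-*-Solver
    inv : (Fin n → Fin n) → Fin n → Fin n → ℕ
    inv τ i j = inverted i j (τ i) (τ j)
    E O : Fin n → Fin n → ℕ
    E i j = inv e₀ i j + inv e₁ i j + inv e₂ i j
    O i j = inv o₀ i j + inv o₁ i j + inv o₂ i j

    cong₃ : ∀ {p p′ q q′ r r′ : ℕ} → p ≡ p′ → q ≡ q′ → r ≡ r′ → p + q + r ≡ p′ + q′ + r′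
    cong₃ refl refl refl = refl

    -- At each of the rows `a`, `b`, `c` the even arrangements take each of the three values once,
    -- and so do the odd ones. At other rows all six agree.
    balanced : ∀ s (h : Fin n → ℕ) → h (e₀ s) + h (e₁ s) + h (e₂ s) ≡ h (o₀ s) + h (o₁ s) + h (o₂ s)
    balanced s h with s ≟ a | s ≟ b | s ≟ c
    ... | yes refl | _ | _
      rewrite at₁ E₀ | at₁ E₁ | at₁ E₂ | at₁ O₀ | at₁ O₁ | at₁ O₂ =
      solve 3 (λ x y z → x :+ y :+ z := y :+ x :+ z) refl (h x) (h y) (h z)
    ... | _ | yes refl | _
      rewrite at₂ E₀ | at₂ E₁ | at₂ E₂ | at₂ O₀ | at₂ O₁ | at₂ O₂ =
      solve 3 (λ x y z → y :+ z :+ x := x :+ z :+ y) refl (h x) (h y) (h z)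
    ... | _ | _ | yes refl
      rewrite at₃ E₀ | at₃ E₁ | at₃ E₂ | at₃ O₀ | at₃ O₁ | at₃ O₂ =
      solve 3 (λ x y z → z :+ x :+ y := z :+ y :+ x) refl (h x) (h y) (h z)
    ... | no s≢a | no s≢b | no s≢c
      rewrite off E₁ s s≢a s≢b s≢c | off E₂ s s≢a s≢b s≢c
            | off O₀ s s≢a s≢b s≢c | off O₁ s s≢a s≢b s≢c | off O₂ s s≢a s≢b s≢c = refl

    row-off : ∀ i → i ≢ a → i ≢ b → i ≢ c → ∀ j → E i j ≡ O i j
    row-off i i≢a i≢b i≢c j
      rewrite off E₁ i i≢a i≢b i≢c | off E₂ i i≢a i≢b i≢c
            | off O₀ i i≢a i≢b i≢c | off O₁ i i≢a i≢b i≢c | off O₂ i i≢a i≢b i≢c = balanced j (inverted i j (e₀ i))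

    column-off : ∀ i j → j ≢ a → j ≢ b → j ≢ c → E i j ≡ O i j
    column-off i j j≢a j≢b j≢c
      rewrite off E₁ j j≢a j≢b j≢c | off E₂ j j≢a j≢b j≢c
            | off O₀ j j≢a j≢b j≢c | off O₁ j j≢a j≢b j≢c | off O₂ j j≢a j≢b j≢c = balanced i (λ u → inverted i j u (e₀ j))

    row : Fin 3 → Fin n
    row = arrange a b c
    val : Fin 3 → Fin n
    val = arrange x y z

    ΣE ΣO : Fin n → ℕ
    ΣE i = ℕSum.sum (E i)
    ΣO i = ℕSum.sum (O i)

    by-rows : ℕSum.sum ΣE + (ΣO a + ΣO b + ΣO c) ≡ ℕSum.sum ΣO + (ΣE a + ΣE b + ΣE c)
    by-rows = sum-differ₃ a≢b a≢c b≢c λ i i≢a i≢b i≢c → ℕSum.sum-cong-≗ (row-off i i≢a i≢b i≢c)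

    by-columns : ∀ i → ΣE i + (O i a + O i b + O i c) ≡ ΣO i + (E i a + E i b + E i c)
    by-columns i = sum-differ₃ a≢b a≢c b≢c (column-off i)

    E₉ O₉ : ℕ
    E₉ = threeByThree λ i j → E (row i) (row j)
    O₉ = threeByThree λ i j → O (row i) (row j)

    -- Discarding the other rows, and then the other columns inside rows `a`, `b`, `c`, leaves the
    -- nine cells of the block.
    reduce : ℕSum.sum ΣE + O₉ ≡ ℕSum.sum ΣO + E₉
    reduce = assemble (ℕSum.sum ΣE) (ℕSum.sum ΣO) (ΣE a) (ΣE b) (ΣE c) (ΣO a) (ΣO b) (ΣO c) _ _ _ _ _ _
               by-rows (by-columns a) (by-columns b) (by-columns c)
      where
      assemble : ∀ s t fa fb fc ga gb gc ea eb ec oa ob oc → s + (ga + gb + gc) ≡ t + (fa + fb + fc) →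
                fa + oa ≡ ga + ea → fb + ob ≡ gb + eb → fc + oc ≡ gc + ec →
                s + (oa + ob + oc) ≡ t + (ea + eb + ec)
      assemble s t fa fb fc ga gb gc ea eb ec oa ob oc p pa pb pc = ℕₚ.+-cancelʳ-≡ (ga + gb + gc) _ _ (begin
        s + (oa + ob + oc) + (ga + gb + gc)     ≡⟨ solve 3 (λ s o g → s :+ o :+ g := s :+ g :+ o) refl s (oa + ob + oc) (ga + gb + gc) ⟩
        s + (ga + gb + gc) + (oa + ob + oc)     ≡⟨ cong (_+ (oa + ob + oc)) p ⟩
        t + (fa + fb + fc) + (oa + ob + oc)     ≡⟨ solve 7 (λ t fa fb fc oa ob oc → t :+ (fa :+ fb :+ fc) :+ (oa :+ ob :+ oc) := t :+ (fa :+ oa :+ (fb :+ ob) :+ (fc :+ oc))) refl t fa fb fc oa ob oc ⟩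
        t + (fa + oa + (fb + ob) + (fc + oc))   ≡⟨ cong (t +_) (cong₃ pa pb pc) ⟩
        t + (ga + ea + (gb + eb) + (gc + ec))   ≡⟨ solve 7 (λ t fa fb fc oa ob oc → t :+ (fa :+ oa :+ (fb :+ ob) :+ (fc :+ oc)) := t :+ (oa :+ ob :+ oc) :+ (fa :+ fb :+ fc)) refl t ga gb gc ea eb ec ⟩
        t + (ea + eb + ec) + (ga + gb + gc)     ∎)

    _<ᵇ_ : Fin n → Fin n → Bool
    i <ᵇ j = does (i Fin.<? j)

    block : ∀ {τ u v w κ} → Rearranges e₀ a b c u v w τ → (∀ i → arrange u v w i ≡ val (κ i)) →
      ∀ i j → inv τ (row i) (row j) ≡
              bit (order (a <ᵇ b) (b <ᵇ c) (a <ᵇ c) i j ∧ order (x <ᵇ y) (y <ᵇ z) (x <ᵇ z) (κ j) (κ i))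
    block {τ} {u} {v} {w} {κ} R eq i j =
      trans (cong₂ (inverted (row i) (row j)) (value i) (value j))
            (cong₂ (λ p q → bit (p ∧ q)) (order-correct a≢b a≢c b≢c i j) (order-correct x≢y x≢z y≢z (κ j) (κ i)))
      where
      value : ∀ i → τ (row i) ≡ val (κ i)
      value 0F = trans (at₁ R) (eq 0F)
      value 1F = trans (at₂ R) (eq 1F)
      value 2F = trans (at₃ R) (eq 2F)

    each : ∀ {A : Set} {f g : Fin 3 → A} → f 0F ≡ g 0F → f 1F ≡ g 1F → f 2F ≡ g 2F → ∀ i → f i ≡ g i
    each p q r 0F = p
    each p q r 1F = q
    each p q r 2F = r

    E₉-count : E₉ ≡ countInversions evens (order (a <ᵇ b) (b <ᵇ c) (a <ᵇ c)) (order (x <ᵇ y) (y <ᵇ z) (x <ᵇ z))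
    E₉-count = threeByThree-cong λ i j → cong₃
      (block {κ = evens 0F} E₀ (each refl refl refl) i j)
      (block {κ = evens 1F} E₁ (each refl refl refl) i j)
      (block {κ = evens 2F} E₂ (each refl refl refl) i j)

    O₉-count : O₉ ≡ countInversions odds (order (a <ᵇ b) (b <ᵇ c) (a <ᵇ c)) (order (x <ᵇ y) (y <ᵇ z) (x <ᵇ z))
    O₉-count = threeByThree-cong λ i j → cong₃
      (block {κ = odds 0F} O₀ (each refl refl refl) i j)
      (block {κ = odds 1F} O₁ (each refl refl refl) i j)
      (block {κ = odds 2F} O₂ (each refl refl refl) i j)

    differ : E₉ ≡ suc O₉ ⊎ O₉ ≡ suc E₉
    differ rewrite E₉-count | O₉-count =
      countInversions-differ (a <ᵇ b) (b <ᵇ c) (a <ᵇ c) (x <ᵇ y) (y <ᵇ z) (x <ᵇ z)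
        (order-transitive a≢b a≢c b≢c) (order-transitive x≢y x≢z y≢z)

    total : ∀ (τ₀ τ₁ τ₂ : Fin n → Fin n) →
      ℕSum.sum (λ i → ℕSum.sum (λ j → inv τ₀ i j + inv τ₁ i j + inv τ₂ i j)) ≡
      inversions τ₀ + inversions τ₁ + inversions τ₂
    total τ₀ τ₁ τ₂ = begin
      ℕSum.sum (λ i → ℕSum.sum (λ j → inv τ₀ i j + inv τ₁ i j + inv τ₂ i j))
        ≡⟨ ℕSum.sum-cong-≗ (λ i → split (inv τ₀ i) (inv τ₁ i) (inv τ₂ i)) ⟩
      ℕSum.sum (λ i → ℕSum.sum (inv τ₀ i) + ℕSum.sum (inv τ₁ i) + ℕSum.sum (inv τ₂ i))
        ≡⟨ split _ _ _ ⟩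
      ℕSum.sum (λ i → ℕSum.sum (inv τ₀ i)) + ℕSum.sum (λ i → ℕSum.sum (inv τ₁ i)) + ℕSum.sum (λ i → ℕSum.sum (inv τ₂ i))
        ≡⟨ cong₃ (inversions-sum τ₀) (inversions-sum τ₁) (inversions-sum τ₂) ⟨
      inversions τ₀ + inversions τ₁ + inversions τ₂ ∎
      where
      split : ∀ (f g h : Fin n → ℕ) → ℕSum.sum (λ i → f i + g i + h i) ≡ ℕSum.sum f + ℕSum.sum g + ℕSum.sum h
      split f g h = trans (ℕSum.∑-distrib-+ (λ i → f i + g i) h) (cong (_+ ℕSum.sum h) (ℕSum.∑-distrib-+ f g))

    excess : ∀ {s t e o} → s + o ≡ t + e → e ≡ suc o ⊎ o ≡ suc e → s ≡ suc t ⊎ t ≡ suc s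
    excess {s} {t} {e} {o} eq (inj₁ refl) = inj₁ (ℕₚ.+-cancelʳ-≡ o _ _ (trans eq (ℕₚ.+-suc t o)))
    excess {s} {t} {e} {o} eq (inj₂ refl) = inj₂ (ℕₚ.+-cancelʳ-≡ e _ _ (trans (sym eq) (ℕₚ.+-suc s e)))

    conclude : inversions e₀ + inversions e₁ + inversions e₂ ≡ suc (inversions o₀ + inversions o₁ + inversions o₂)
             ⊎ inversions o₀ + inversions o₁ + inversions o₂ ≡ suc (inversions e₀ + inversions e₁ + inversions e₂)
    conclude rewrite sym (total e₀ e₁ e₂) | sym (total o₀ o₁ o₂) = excess reduce differ

  -- Extend the three prescribed values to a permutation `σ`. Composing it with the identity and the
  -- two 3-cycles of `a`, `b`, `c` gives the even arrangements, with the three transpositions the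
  -- odd ones.
  hexagon-through : ∀ {n} {a b c x y z : Fin n} → a ≢ b → a ≢ c → b ≢ c → x ≢ y → x ≢ z → y ≢ z →
    ∃ λ σ → Inj σ × Hexagon a b c x y z
      σ (σ ∘ transpose a b ∘ transpose b c) (σ ∘ transpose b c ∘ transpose a b)
      (σ ∘ transpose a b) (σ ∘ transpose b c) (σ ∘ transpose a c)
  hexagon-through {a = a} {b} {c} {x} {y} {z} a≢b a≢c b≢c x≢y x≢z y≢z
    with injection-through₃ a≢b a≢c b≢c x≢y x≢z y≢z
  ... | σ , inj , refl , refl , refl = σ , inj , record
    { a≢b = a≢b ; a≢c = a≢c ; b≢c = b≢c ; x≢y = x≢y ; x≢z = x≢z ; y≢z = y≢z
    ; E₀ = rearranges refl refl refl (λ _ _ _ _ → refl)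
    ; E₁ = rearranges (cong σ (trans (cong (transpose a b) bc-a) ab-a))
                      (cong σ (trans (cong (transpose a b) bc-b) ab-c))
                      (cong σ (trans (cong (transpose a b) bc-c) ab-b))
                      (λ s s≢a s≢b s≢c → cong σ (trans (cong (transpose a b) (transpose-other b c s≢b s≢c)) (transpose-other a b s≢a s≢b)))
    ; E₂ = rearranges (cong σ (trans (cong (transpose b c) ab-a) bc-b))
                      (cong σ (trans (cong (transpose b c) ab-b) bc-a))
                      (cong σ (trans (cong (transpose b c) ab-c) bc-c))
                      (λ s s≢a s≢b s≢c → cong σ (trans (cong (transpose b c) (transpose-other a b s≢a s≢b)) (transpose-other b c s≢b s≢c)))
    ; O₀ = rearranges (cong σ ab-a) (cong σ ab-b) (cong σ ab-c)
                      (λ s s≢a s≢b _ → cong σ (transpose-other a b s≢a s≢b))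
    ; O₁ = rearranges (cong σ bc-a) (cong σ bc-b) (cong σ bc-c)
                      (λ s _ s≢b s≢c → cong σ (transpose-other b c s≢b s≢c))
    ; O₂ = rearranges (cong σ (transpose-left a c)) (cong σ (transpose-other a c (a≢b ∘ sym) b≢c)) (cong σ (transpose-right a c))
                      (λ s s≢a _ s≢c → cong σ (transpose-other a c s≢a s≢c))
    }
    where
    ab-a = transpose-left a b
    ab-b = transpose-right a b
    ab-c = transpose-other a b (a≢c ∘ sym) (b≢c ∘ sym)
    bc-a = transpose-other b c a≢b a≢c
    bc-b = transpose-left b c
    bc-c = transpose-right b c

open Permutations

-- The Boolean injectivity test.

allᵇ-sound : ∀ {A : Set} (p : A → Bool) {n} (f : Fin n → A) → allᵇ p (tabulate f) ≡ true → ∀ i → p (f i) ≡ true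
allᵇ-sound p f eq zero with p (f zero) | eq
... | true | _ = ≡.refl
allᵇ-sound p f eq (suc i) with p (f zero) | eq
... | true | rest = allᵇ-sound p (f ∘ suc) rest i

allᵇ-complete : ∀ {A : Set} (p : A → Bool) {n} (f : Fin n → A) → (∀ i → p (f i) ≡ true) → allᵇ p (tabulate f) ≡ true
allᵇ-complete p {zero}  f eq = ≡.refl
allᵇ-complete p {suc n} f eq rewrite eq zero = allᵇ-complete p (f ∘ suc) (eq ∘ suc)

isInjectiveᵇ-sound : ∀ {n} {σ : Fin n → Fin n} → isInjectiveᵇ σ ≡ true → Inj σ
isInjectiveᵇ-sound {n} {σ} eq {i} {j} σi≡σj
  with σ i ≟ σ j | i ≟ j | allᵇ-sound (λ j → not (does (σ i ≟ σ j)) ∨ does (i ≟ j)) id (allᵇ-sound _ id eq i) j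
... | _          | yes i≡j | _ = i≡j
... | no σi≢σj   | no _    | _ = contradiction σi≡σj σi≢σj

isInjectiveᵇ-complete : ∀ {n} {σ : Fin n → Fin n} → Inj σ → isInjectiveᵇ σ ≡ true
isInjectiveᵇ-complete {n} {σ} inj = allᵇ-complete _ id λ i → allᵇ-complete _ id λ j → entry i j
  where
  entry : ∀ i j → not (does (σ i ≟ σ j)) ∨ does (i ≟ j) ≡ true
  entry i j with σ i ≟ σ j | i ≟ j
  ... | no _      | _       = ≡.refl
  ... | yes _     | yes _   = ≡.refl
  ... | yes σi≡σj | no i≢j  = contradiction (inj σi≡σj) i≢j

injective? : ∀ {n} (σ : Fin n → Fin n) → Dec (Inj σ)
injective? σ with isInjectiveᵇ σ in eq
... | true  = yes (isInjectiveᵇ-sound eq)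
... | false = no λ inj → contradiction (≡.trans (≡.sym eq) (isInjectiveᵇ-complete inj)) λ ()

Inj-cong : ∀ {n} {σ τ : Fin n → Fin n} → σ ≗ τ → Inj σ → Inj τ
Inj-cong σ≗τ inj {i} {j} eq = inj (≡.trans (σ≗τ i) (≡.trans eq (≡.sym (σ≗τ j))))

isInjectiveᵇ-false : ∀ {n} {σ : Fin n → Fin n} → ¬ Inj σ → isInjectiveᵇ σ ≡ false
isInjectiveᵇ-false {σ = σ} ¬inj with isInjectiveᵇ σ in eq
... | true  = ⊥-elim (¬inj (isInjectiveᵇ-sound eq))
... | false = ≡.refl

isInjectiveᵇ-cong : ∀ {n} {σ τ : Fin n → Fin n} → σ ≗ τ → isInjectiveᵇ σ ≡ isInjectiveᵇ τ
isInjectiveᵇ-cong {σ = σ} {τ} σ≗τ with injective? σ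
... | yes inj = ≡.trans (isInjectiveᵇ-complete inj) (≡.sym (isInjectiveᵇ-complete (Inj-cong σ≗τ inj)))
... | no ¬inj = ≡.trans (isInjectiveᵇ-false ¬inj) (≡.sym (isInjectiveᵇ-false (λ inj → ¬inj (Inj-cong (≡.sym ∘ σ≗τ) inj))))

-- Sums and products with at most two nontrivial terms.

module FewTerms {a ℓ} (M : CommutativeMonoid a ℓ) where
  open CommutativeMonoid M
  open MonoidSum M using (sum; sum-remove; sum-cong-≋; sum-replicate-zero)

  sum-ε : ∀ {n} {f : Fin n → Carrier} → (∀ i → f i ≈ ε) → sum f ≈ ε
  sum-ε {n} f≈ε = trans (sum-cong-≋ f≈ε) (sum-replicate-zero n)

  sum-single : ∀ {n} (i : Fin n) {f : Fin n → Carrier} → (∀ j → j ≢ i → f j ≈ ε) → sum f ≈ f i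
  sum-single {suc n} i {f} others =
    trans (sum-remove {i = i} f) (trans (∙-congˡ (sum-ε λ j → others _ (punchInᵢ≢i i j))) (identityʳ _))

  sum-pair : ∀ {n} {i j : Fin n} → i ≢ j → {f : Fin n → Carrier} →
             (∀ k → k ≢ i → k ≢ j → f k ≈ ε) → sum f ≈ f i ∙ f j
  sum-pair {suc n} {i} {j} i≢j {f} others =
    trans (sum-remove {i = i} f) (∙-congˡ
      (trans (sum-single (punchOut i≢j) {λ k → f (punchIn i k)} λ k k≢ → others _ (punchInᵢ≢i i k)
                (λ eq → k≢ (≡.trans (≡.sym (punchOut-punchIn′ k)) (punchOut-cong′ eq))))
             (reflexive (≡.cong f (punchIn-punchOut i≢j)))))
    where
    punchOut-punchIn′ : ∀ k → punchOut {i = i} {j = punchIn i k} (≡.≢-sym (punchInᵢ≢i i k)) ≡ k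
    punchOut-punchIn′ k = ≡.trans (punchOut-cong i ≡.refl) (punchOut-punchIn i)
    punchOut-cong′ : ∀ {k} → punchIn i k ≡ j → punchOut {i = i} {j = punchIn i k} (≡.≢-sym (punchInᵢ≢i i k)) ≡ punchOut i≢j
    punchOut-cong′ = punchOut-cong i

-- Sums over all functions, and differences of forms on matrices.

module Field {c ℓ : Level} (R : CommutativeRing c ℓ) where
  open CommutativeRing R hiding (zero) renaming (Carrier to K) public
  open Over R public
  open SemiringSum semiring public
  module ∑-few = FewTerms +-commutativeMonoid
  module ∏-few = FewTerms *-commutativeMonoid
  module ∏Sum = MonoidSum *-commutativeMonoid
  open Exp semiring using (_^_; ^-homo-*) public
  open RingProperties ring using (+-cancelˡ; +-cancelʳ) public
  open SetoidReasoning setoid public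
  open SemiringSolver commutativeSemiring using (solve; _:=_; _:+_; _:*_; con) public

  prod : ∀ {n} → (Fin n → K) → K
  prod = ∏Sum.sum

  prod-zero : ∀ {n} (i : Fin n) {f : Fin n → K} → f i ≈ 0# → prod f ≈ 0#
  prod-zero {suc n} i {f} fi≈0 = trans (∏Sum.sum-remove {i = i} f) (trans (*-congʳ fi≈0) (zeroˡ _))

  ∏-prod : ∀ {n} (f : Fin n → K) → ∏ f ≈ prod f
  ∏-prod f = go id f
    where
    go : ∀ {A : Set} {n} (g : Fin n → A) (f : A → K) → List.foldr _*_ 1# (map f (tabulate g)) ≈ prod (f ∘ g)
    go {n = zero}  g f = refl
    go {n = suc n} g f = *-congˡ (go (g ∘ suc) f)

  ∑-cong : ∀ {A : Set} {t u : A → K} (L : List A) → (∀ x → t x ≈ u x) → ∑ (map t L) ≈ ∑ (map u L)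
  ∑-cong []       eq = refl
  ∑-cong (x ∷ xs) eq = +-cong (eq x) (∑-cong xs eq)

  ∑-zero : ∀ {A : Set} {t : A → K} (L : List A) → (∀ x → t x ≈ 0#) → ∑ (map t L) ≈ 0#
  ∑-zero []       eq = refl
  ∑-zero (x ∷ xs) eq = trans (+-cong (eq x) (∑-zero xs eq)) (+-identityˡ 0#)

  ∑-+ : ∀ {A : Set} (t u : A → K) (L : List A) → ∑ (map t L) + ∑ (map u L) ≈ ∑ (map (λ x → t x + u x) L)
  ∑-+ t u []       = +-identityˡ 0#
  ∑-+ t u (x ∷ xs) = begin
    t x + ∑ (map t xs) + (u x + ∑ (map u xs))
      ≈⟨ solve 4 (λ a b c d → a :+ b :+ (c :+ d) := a :+ c :+ (b :+ d)) refl _ _ _ _ ⟩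
    t x + u x + (∑ (map t xs) + ∑ (map u xs))  ≈⟨ +-congˡ (∑-+ t u xs) ⟩
    t x + u x + ∑ (map (λ x → t x + u x) xs)   ∎

  ∑-++ : ∀ {A : Set} (t : A → K) (L M : List A) → ∑ (map t (L ++ M)) ≈ ∑ (map t L) + ∑ (map t M)
  ∑-++ t []       M = sym (+-identityˡ _)
  ∑-++ t (x ∷ xs) M = trans (+-congˡ (∑-++ t xs M)) (sym (+-assoc _ _ _))

  ∑-map : ∀ {A B : Set} (t : B → K) (h : A → B) (L : List A) → ∑ (map t (map h L)) ≈ ∑ (map (t ∘ h) L)
  ∑-map t h []       = refl
  ∑-map t h (x ∷ xs) = +-congˡ (∑-map t h xs)

  ∑-concatMap : ∀ {A B : Set} (t : B → K) (h : A → List B) {n} (g : Fin n → A) →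
                ∑ (map t (concatMap h (tabulate g))) ≈ sum (λ i → ∑ (map t (h (g i))))
  ∑-concatMap t h {zero}  g = refl
  ∑-concatMap t h {suc n} g = trans (∑-++ t (h (g zero)) _) (+-congˡ (∑-concatMap t h (g ∘ suc)))

  ∑-filter : ∀ {A : Set} (p : A → Bool) (t : A → K) (L : List A) →
             ∑ (map t (filterᵇ p L)) ≈ ∑ (map (λ x → if p x then t x else 0#) L)
  ∑-filter p t []       = refl
  ∑-filter p t (x ∷ xs) with p x
  ... | true  = +-congˡ (∑-filter p t xs)
  ... | false = trans (∑-filter p t xs) (sym (+-identityˡ _))

  -- Functions are identified only pointwise, so a summand has to respect pointwise equality before
  -- one of its terms can be singled out.
  Extensional : ∀ {m k} → ((Fin m → Fin k) → K) → Set ℓ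
  Extensional t = ∀ {f g} → f ≗ g → t f ≈ t g

  ∑ᶠ : ∀ {m k} → ((Fin m → Fin k) → K) → K
  ∑ᶠ {m} {k} t = ∑ (map t (allFunctions m k))

  ∑ᶠ-suc : ∀ {m k} (t : (Fin (suc m) → Fin k) → K) → Extensional t →
           ∑ᶠ t ≈ sum (λ a → ∑ᶠ {m} {k} (λ f → t (a Vector.∷ f)))
  ∑ᶠ-suc {m} {k} t ext = ∑-allFunctions _ λ a f → λ { zero → ≡.refl ; (suc i) → ≡.refl }
    where
    -- The extension inside `allFunctions` is a pattern-matching lambda distinct from `Vector.∷`. It
    -- enters as an arbitrary `h` that agrees with it pointwise.
    ∑-allFunctions : (h : Fin k → (Fin m → Fin k) → Fin (suc m) → Fin k) → (∀ a f → h a f ≗ a Vector.∷ f) →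
      ∑ (map t (concatMap (λ a → map (h a) (allFunctions m k)) (allFin k))) ≈
      sum {k} (λ a → ∑ᶠ {m} {k} (λ f → t (a Vector.∷ f)))
    ∑-allFunctions h h≗ = trans (∑-concatMap t (λ a → map (h a) (allFunctions m k)) {k} id) (sum-cong-≋ {k} λ a →
      trans (∑-map t (h a) (allFunctions m k)) (∑-cong (allFunctions m k) λ f → ext (h≗ a f)))

  ∑ᶠ-single : ∀ {m k} {t : (Fin m → Fin k) → K} → Extensional t → ∀ g → (∀ f → ¬ f ≗ g → t f ≈ 0#) → ∑ᶠ t ≈ t g
  ∑ᶠ-single {zero}  {k} {t} ext g others = trans (+-identityʳ _) (ext λ ())
  ∑ᶠ-single {suc m} {k} {t} ext g others = begin
    ∑ᶠ t                                                 ≈⟨ ∑ᶠ-suc t ext ⟩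
    sum (λ a → ∑ᶠ (λ f → t (a Vector.∷ f)))
      ≈⟨ ∑-few.sum-single (g zero) (λ a a≢g₀ → ∑-zero (allFunctions m k) λ f → others _ λ eq → a≢g₀ (eq zero)) ⟩
    ∑ᶠ (λ f → t (g zero Vector.∷ f))
      ≈⟨ ∑ᶠ-single (λ f≗f′ → ext λ { zero → ≡.refl ; (suc i) → f≗f′ i }) (g ∘ suc) (λ f f≢g → others _ λ eq → f≢g (eq ∘ suc)) ⟩
    t (g zero Vector.∷ (g ∘ suc))                        ≈⟨ ext (λ { zero → ≡.refl ; (suc i) → ≡.refl }) ⟩
    t g                                                  ∎

  -- The summand splits into a part supported at `g` and a part supported at `h`, each a sum with a
  -- single term.
  ∑ᶠ-pair : ∀ {m k} {t : (Fin m → Fin k) → K} → Extensional t → ∀ g h → ¬ g ≗ h →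
            (∀ f → ¬ f ≗ g → ¬ f ≗ h → t f ≈ 0#) → ∑ᶠ t ≈ t g + t h
  ∑ᶠ-pair {m} {k} {t} ext g h g≢h others = begin
    ∑ᶠ t                        ≈⟨ ∑-cong (allFunctions m k) split ⟩
    ∑ᶠ (λ f → only g f + only h f)  ≈⟨ ∑-+ (only g) (only h) (allFunctions m k) ⟨
    ∑ᶠ (only g) + ∑ᶠ (only h)   ≈⟨ +-cong (single g) (single h) ⟩
    t g + t h                   ∎
    where
    agrees? : ∀ f g → Dec (f ≗ g)
    agrees? f g = all? λ i → f i ≟ g i
    only : (Fin m → Fin k) → (Fin m → Fin k) → K
    only g f = if does (agrees? f g) then t f else 0#
    on : ∀ {f g} → f ≗ g → only g f ≈ t f
    on {f} {g} f≗g rewrite dec-true (agrees? f g) f≗g = refl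
    away : ∀ {f g} → ¬ f ≗ g → only g f ≈ 0#
    away {f} {g} f≢g rewrite dec-false (agrees? f g) f≢g = refl
    only-ext : ∀ g → Extensional (only g)
    only-ext g {f} {f′} f≗f′ = case agrees? f g of λ where
      (yes f≗g) → trans (on f≗g) (trans (ext f≗f′) (sym (on λ i → ≡.trans (≡.sym (f≗f′ i)) (f≗g i))))
      (no f≢g)  → trans (away f≢g) (sym (away λ f′≗g → f≢g λ i → ≡.trans (f≗f′ i) (f′≗g i)))
    single : ∀ g → ∑ᶠ (only g) ≈ t g
    single g = trans (∑ᶠ-single (only-ext g) g (λ f → away)) (on λ _ → ≡.refl)
    split : ∀ f → t f ≈ only g f + only h f
    split f = case agrees? f g of λ where
      (yes f≗g) → trans (sym (+-identityʳ _)) (+-cong (sym (on f≗g))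
                    (sym (away λ f≗h → g≢h λ i → ≡.trans (≡.sym (f≗g i)) (f≗h i))))
      (no f≢g)  → case agrees? f h of λ where
        (yes f≗h) → trans (sym (+-identityˡ _)) (+-cong (sym (away f≢g)) (sym (on f≗h)))
        (no f≢h)  → trans (others f f≢g f≢h) (trans (sym (+-identityˡ 0#)) (+-cong (sym (away f≢g)) (sym (away f≢h))))

  _⊕_ : ∀ {n} → Matrix n → Matrix n → Matrix n
  (X ⊕ Y) i j = X i j + Y i j

  O : ∀ {n} → Matrix n
  O i j = 0#

  infix 4 _≋_
  _≋_ : ∀ {n} → Matrix n → Matrix n → Set ℓ
  X ≋ Y = ∀ i j → X i j ≈ Y i j

  δ : ∀ {n} → Fin n → Fin n → K
  δ i j = if does (i ≟ j) then 1# else 0#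

  δ-refl : ∀ {n} (i : Fin n) → δ i i ≈ 1#
  δ-refl i rewrite dec-true (i ≟ i) ≡.refl = refl

  δ-≢ : ∀ {n} {i j : Fin n} → i ≢ j → δ i j ≈ 0#
  δ-≢ {i = i} {j} i≢j rewrite dec-false (i ≟ j) i≢j = refl

  -- Freezes the rows in `S` to those of `E`, leaving a form in the other rows of `X`.
  replaceRows : ∀ {n} → (Fin n → Bool) → Matrix n → Matrix n → Matrix n
  replaceRows S E X i j = if S i then E i j else X i j

  -- One shape for two uses: the vanishing second difference `Flat`, and invariance under
  -- translation by `Y`, which is the case `Y`, `O`, `O`, `O`.
  FourPoint : ∀ {n} → (Matrix n → K) → (P Q U V : Matrix n) → Set (c ⊔ ℓ)
  FourPoint F P Q U V = ∀ B → F (B ⊕ P) + F (B ⊕ Q) ≈ F (B ⊕ U) + F (B ⊕ V)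

  -- Degree at most one in the direction Y, as a vanishing second difference.
  Flat : ∀ {n} → (Matrix n → K) → Matrix n → Set (c ⊔ ℓ)
  Flat F Y = FourPoint F (Y ⊕ Y) O Y Y

  -- The q-permanent: multilinearity, frozen rows, flatness of lines.

  module QPermanent (q : K) {n : ℕ} where
    -- Opaque, so that their arguments can be inferred by unification.
    abstract
      P : Matrix n → K
      P = qPer q

      P-def : ∀ X → P X ≈ qPer q X
      P-def X = refl

      -- Extended by zero to maps that are not injective, so that sums run over all functions.
      weight : (Fin n → Fin n) → K
      weight σ = if isInjectiveᵇ σ then q ^ inversions σ else 0#

      weight-injective : ∀ {σ} → Inj σ → weight σ ≈ q ^ inversions σ
      weight-injective inj rewrite isInjectiveᵇ-complete inj = refl

      weight-zero : ∀ {σ} → ¬ Inj σ → weight σ ≈ 0#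
      weight-zero ¬inj rewrite isInjectiveᵇ-false ¬inj = refl

      weight-ext : Extensional weight
      weight-ext {σ} {τ} σ≗τ rewrite isInjectiveᵇ-cong σ≗τ | inversions-cong σ≗τ = refl

    term : Matrix n → (Fin n → Fin n) → K
    term X σ = weight σ * prod (λ i → X i (σ i))

    term-ext : ∀ X → Extensional (term X)
    term-ext X σ≗τ = *-cong (weight-ext σ≗τ) (∏Sum.sum-cong-≋ λ i → reflexive (≡.cong (X i) (σ≗τ i)))

    abstract
      expand : ∀ X → P X ≈ ∑ᶠ (term X)
      expand X = trans (∑-filter isInjectiveᵇ _ (allFunctions n n)) (∑-cong (allFunctions n n) each)
        where
        each : ∀ σ → (if isInjectiveᵇ σ then (q ^ inversions σ) * ∏ (λ i → X i (σ i)) else 0#) ≈ term X σ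
        each σ with isInjectiveᵇ σ
        ... | true  = *-congˡ (∏-prod {n} (λ i → X i (σ i)))
        ... | false = sym (zeroˡ _)

    P-cong : ∀ {X Y} → X ≋ Y → P X ≈ P Y
    P-cong {X} {Y} X≋Y = begin
      P X     ≈⟨ expand X ⟩
      ∑ᶠ (term X)  ≈⟨ ∑-cong (allFunctions n n) (λ σ → *-congˡ (∏Sum.sum-cong-≋ λ i → X≋Y i (σ i))) ⟩
      ∑ᶠ (term Y)  ≈⟨ expand Y ⟨
      P Y     ∎

    -- Each product contains exactly one entry of row `r`.
    row-additive : ∀ r {X Y Z : Matrix n} → (∀ j → Z r j ≈ X r j + Y r j) →
                   (∀ i → i ≢ r → ∀ j → X i j ≈ Z i j) → (∀ i → i ≢ r → ∀ j → Y i j ≈ Z i j) →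
                   P Z ≈ P X + P Y
    row-additive r {X} {Y} {Z} row X~Z Y~Z = begin
      P Z                          ≈⟨ expand Z ⟩
      ∑ᶠ (term Z)                       ≈⟨ ∑-cong (allFunctions n n) each ⟩
      ∑ᶠ (λ σ → term X σ + term Y σ)    ≈⟨ ∑-+ (term X) (term Y) (allFunctions n n) ⟨
      ∑ᶠ (term X) + ∑ᶠ (term Y)         ≈⟨ +-cong (expand X) (expand Y) ⟨
      P X + P Y               ∎
      where
      split : ∀ {m} (r : Fin m) {f g h : Fin m → K} → h r ≈ f r + g r →
              (∀ i → i ≢ r → f i ≈ h i) → (∀ i → i ≢ r → g i ≈ h i) → prod h ≈ prod f + prod g
      split {suc m} r {f} {g} {h} at-r f~h g~h = begin
        prod h                    ≈⟨ ∏Sum.sum-remove {i = r} h ⟩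
        h r * rest                ≈⟨ *-congʳ at-r ⟩
        (f r + g r) * rest        ≈⟨ distribʳ _ _ _ ⟩
        f r * rest + g r * rest   ≈⟨ +-cong (*-congˡ (∏Sum.sum-cong-≋ λ i → sym (f~h _ (punchInᵢ≢i r i))))
                                            (*-congˡ (∏Sum.sum-cong-≋ λ i → sym (g~h _ (punchInᵢ≢i r i)))) ⟩
        f r * _ + g r * _         ≈⟨ +-cong (∏Sum.sum-remove {i = r} f) (∏Sum.sum-remove {i = r} g) ⟨
        prod f + prod g           ∎
        where rest = prod (λ i → h (punchIn r i))
      each : ∀ σ → term Z σ ≈ term X σ + term Y σ
      each σ = trans (*-congˡ (split r (row (σ r)) (λ i i≢r → X~Z i i≢r (σ i)) (λ i i≢r → Y~Z i i≢r (σ i))))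
                     (distribˡ _ _ _)

    P-monomial : ∀ {X : Matrix n} σ → (∀ i j → j ≢ σ i → X i j ≈ 0#) →
                    P X ≈ weight σ * prod (λ i → X i (σ i))
    P-monomial {X} σ zeros = trans (expand X) (∑ᶠ-single (term-ext X) σ others)
      where
      others : ∀ τ → ¬ τ ≗ σ → term X τ ≈ 0#
      others τ τ≢σ with ¬∀⟶∃¬ n _ (λ i → τ i ≟ σ i) τ≢σ
      ... | i , τi≢σi = trans (*-congˡ (prod-zero i (zeros i (τ i) τi≢σi))) (zeroʳ _)

    module _ {a b : Fin n} (a≢b : a ≢ b) where
      others : Fin n → Bool
      others i = not (does (i ≟ a) ∨ does (i ≟ b))

      others-a : others a ≡ false
      others-a rewrite dec-true (a ≟ a) ≡.refl = ≡.refl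

      others-b : others b ≡ false
      others-b with b ≟ a
      ... | yes _ = ≡.refl
      ... | no _ rewrite dec-true (b ≟ b) ≡.refl = ≡.refl

      others-true : ∀ {i} → i ≢ a → i ≢ b → others i ≡ true
      others-true {i} i≢a i≢b rewrite dec-false (i ≟ a) i≢a | dec-false (i ≟ b) i≢b = ≡.refl

      P-two-rows : ∀ {σ} → Inj σ → ∀ X →
        P (replaceRows others (λ i → δ (σ i)) X) ≈
        weight σ * (X a (σ a) * X b (σ b)) + weight (σ ∘ transpose a b) * (X a (σ b) * X b (σ a))
      P-two-rows {σ} inj X = begin
        P M                  ≈⟨ expand M ⟩
        ∑ᶠ (term M)               ≈⟨ ∑ᶠ-pair (term-ext M) σ σ′ σ≢σ′ vanish ⟩
        term M σ + term M σ′      ≈⟨ +-cong (*-congˡ (trans (∏-few.sum-pair a≢b fixed) (*-cong at-a at-b)))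
                                            (*-congˡ (trans (∏-few.sum-pair a≢b fixed′)
                                              (*-cong (trans at-a (reflexive (≡.cong (X a ∘ σ) (transpose-left a b))))
                                                      (trans at-b (reflexive (≡.cong (X b ∘ σ) (transpose-right a b))))))) ⟩
        _                         ∎
        where
        σ′ = σ ∘ transpose a b
        M = replaceRows others (λ i → δ (σ i)) X
        at-a : ∀ {j} → M a j ≈ X a j
        at-a rewrite others-a = refl
        at-b : ∀ {j} → M b j ≈ X b j
        at-b rewrite others-b = refl
        at-other : ∀ {i} → i ≢ a → i ≢ b → ∀ {j} → M i j ≈ δ (σ i) j
        at-other i≢a i≢b rewrite others-true i≢a i≢b = refl
        fixed : ∀ i → i ≢ a → i ≢ b → M i (σ i) ≈ 1#
        fixed i i≢a i≢b = trans (at-other i≢a i≢b) (δ-refl (σ i))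
        fixed′ : ∀ i → i ≢ a → i ≢ b → M i (σ′ i) ≈ 1#
        fixed′ i i≢a i≢b rewrite transpose-other a b i≢a i≢b = fixed i i≢a i≢b
        σ≢σ′ : ¬ σ ≗ σ′
        σ≢σ′ eq = a≢b (inj (≡.trans (eq a) (≡.cong σ (transpose-left a b))))

        moved : ∀ τ i → i ≢ a → i ≢ b → τ i ≢ σ i → term M τ ≈ 0#
        moved τ i i≢a i≢b τi≢σi =
          trans (*-congˡ (prod-zero i (trans (at-other i≢a i≢b) (δ-≢ (≡.≢-sym τi≢σi))))) (zeroʳ _)

        rigid : ∀ τ → Inj τ → (∀ i → i ≢ a → i ≢ b → τ i ≡ σ i) → τ ≗ σ ⊎ τ ≗ σ′
        rigid τ τ-inj agree = cases (lands a (inj₁ ≡.refl)) (lands b (inj₂ ≡.refl))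
          where
          lands : ∀ s → s ≡ a ⊎ s ≡ b → τ s ≡ σ a ⊎ τ s ≡ σ b
          lands s s∈ with injective⇒surjective inj (τ s)
          ... | x , σx≡τs with x ≟ a | x ≟ b
          ... | yes ≡.refl | _ = inj₁ (≡.sym σx≡τs)
          ... | no _ | yes ≡.refl = inj₂ (≡.sym σx≡τs)
          ... | no x≢a | no x≢b with τ-inj (≡.trans (agree x x≢a x≢b) σx≡τs) | s∈
          ... | x≡s | inj₁ s≡a = contradiction (≡.trans x≡s s≡a) x≢a
          ... | x≡s | inj₂ s≡b = contradiction (≡.trans x≡s s≡b) x≢b
          pointwise : ∀ ρ → (∀ i → i ≢ a → i ≢ b → ρ i ≡ σ i) → τ a ≡ ρ a → τ b ≡ ρ b → τ ≗ ρ
          pointwise ρ ρ~σ τa τb i with i ≟ a | i ≟ b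
          ... | yes ≡.refl | _ = τa
          ... | no _ | yes ≡.refl = τb
          ... | no i≢a | no i≢b = ≡.trans (agree i i≢a i≢b) (≡.sym (ρ~σ i i≢a i≢b))
          cases : τ a ≡ σ a ⊎ τ a ≡ σ b → τ b ≡ σ a ⊎ τ b ≡ σ b → τ ≗ σ ⊎ τ ≗ σ′
          cases (inj₁ τa) (inj₂ τb) = inj₁ (pointwise σ (λ _ _ _ → ≡.refl) τa τb)
          cases (inj₂ τa) (inj₁ τb) = inj₂ (pointwise σ′ (λ i i≢a i≢b → ≡.cong σ (transpose-other a b i≢a i≢b))
            (≡.trans τa (≡.cong σ (≡.sym (transpose-left a b)))) (≡.trans τb (≡.cong σ (≡.sym (transpose-right a b)))))
          cases (inj₁ τa) (inj₁ τb) = contradiction (τ-inj (≡.trans τa (≡.sym τb))) a≢b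
          cases (inj₂ τa) (inj₂ τb) = contradiction (τ-inj (≡.trans τa (≡.sym τb))) a≢b

        vanish : ∀ τ → ¬ τ ≗ σ → ¬ τ ≗ σ′ → term M τ ≈ 0#
        vanish τ τ≢σ τ≢σ′ with injective? τ
        ... | no ¬inj = trans (*-congʳ (weight-zero ¬inj)) (zeroˡ _)
        -- Agreement with `σ` off `a` and `b`, phrased so that it is trivially true at `a` and `b`
        -- and hence decidable over all rows.
        ... | yes τ-inj with all? (λ i → τ i ≟ (if others i then σ i else τ i))
        ... | no disagree = outside (¬∀⟶∃¬ n _ (λ i → τ i ≟ (if others i then σ i else τ i)) disagree)
          where
          outside : (∃ λ i → τ i ≢ (if others i then σ i else τ i)) → term M τ ≈ 0#
          outside (i , ne) with i ≟ a | i ≟ b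
          ... | no i≢a | no i≢b = moved τ i i≢a i≢b ne
          ... | yes _  | _      = contradiction ≡.refl ne
          ... | no _   | yes _  = contradiction ≡.refl ne
        ... | yes agree with rigid τ τ-inj (λ i i≢a i≢b → ≡.subst (λ t → τ i ≡ (if t then σ i else τ i)) (others-true i≢a i≢b) (agree i))
        ... | inj₁ τ≗σ  = contradiction τ≗σ τ≢σ
        ... | inj₂ τ≗σ′ = contradiction τ≗σ′ τ≢σ′

    FourRows : (Fin n → Bool) → (E U V W Z : Matrix n) → Set (c ⊔ ℓ)
    FourRows S E = FourPoint (λ X → P (replaceRows S E X))

    module _ (E U V W Z : Matrix n) where
      fourRows-≗ : ∀ {S T} → S ≗ T → FourRows S E U V W Z → FourRows T E U V W Z
      fourRows-≗ {S} {T} S≗T four B = begin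
        at T U + at T V  ≈⟨ +-cong (same U) (same V) ⟨
        at S U + at S V  ≈⟨ four B ⟩
        at S W + at S Z  ≈⟨ +-cong (same W) (same Z) ⟩
        at T W + at T Z  ∎
        where
        at : (Fin n → Bool) → Matrix n → K
        at S X = P (replaceRows S E (B ⊕ X))
        same : ∀ X → at S X ≈ at T X
        same X = P-cong λ i j → reflexive (≡.cong (λ s → if s then E i j else (B ⊕ X) i j) (S≗T i))

      insert : Fin n → (Fin n → Bool) → Fin n → Bool
      insert r S i = does (i ≟ r) ∨ S i

      -- Adding the row r of E to B changes the value by the value with row r replaced.
      fourRows-insert : ∀ r {S} → FourRows S E U V W Z → FourRows (insert r S) E U V W Z
      fourRows-insert r {S} four with S r in Sr
      ... | true = fourRows-≗ same four
        where
        same : ∀ i → S i ≡ insert r S i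
        same i with i ≟ r
        ... | yes ≡.refl = Sr
        ... | no _ = ≡.refl
      ... | false = λ B → +-cancelʳ (old B U + old B V) _ _ (begin
          new B U + new B V + (old B U + old B V)     ≈⟨ swap (new B U) (new B V) (old B U) (old B V) ⟩
          new B U + old B U + (new B V + old B V)     ≈⟨ +-cong (add B U) (add B V) ⟨
          old (B ⊕ Er) U + old (B ⊕ Er) V             ≈⟨ four (B ⊕ Er) ⟩
          old (B ⊕ Er) W + old (B ⊕ Er) Z             ≈⟨ +-cong (add B W) (add B Z) ⟩
          new B W + old B W + (new B Z + old B Z)     ≈⟨ swap (new B W) (new B Z) (old B W) (old B Z) ⟨
          new B W + new B Z + (old B W + old B Z)     ≈⟨ +-congˡ (four B) ⟨
          new B W + new B Z + (old B U + old B V)     ∎)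
        where
        Er : Matrix n
        Er i j = if does (i ≟ r) then E i j else 0#
        old new : Matrix n → Matrix n → K
        old B X = P (replaceRows S E (B ⊕ X))
        new B X = P (replaceRows (insert r S) E (B ⊕ X))
        swap : ∀ x y z w → x + y + (z + w) ≈ x + z + (y + w)
        swap = solve 4 (λ x y z w → x :+ y :+ (z :+ w) := x :+ z :+ (y :+ w)) refl
        add : ∀ B X → old (B ⊕ Er) X ≈ new B X + old B X
        add B X = row-additive r row off off′
          where
          row : ∀ j → replaceRows S E ((B ⊕ Er) ⊕ X) r j ≈
                      replaceRows (insert r S) E (B ⊕ X) r j + replaceRows S E (B ⊕ X) r j
          row j rewrite Sr | dec-true (r ≟ r) ≡.refl =
            solve 3 (λ b e x → b :+ e :+ x := e :+ (b :+ x)) refl (B r j) (E r j) (X r j)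
          off′ : ∀ i → i ≢ r → ∀ j → replaceRows S E (B ⊕ X) i j ≈ replaceRows S E ((B ⊕ Er) ⊕ X) i j
          off′ i i≢r j rewrite dec-false (i ≟ r) i≢r with S i
          ... | true  = refl
          ... | false = +-congʳ (sym (+-identityʳ _))
          off : ∀ i → i ≢ r → ∀ j → replaceRows (insert r S) E (B ⊕ X) i j ≈ replaceRows S E ((B ⊕ Er) ⊕ X) i j
          off i i≢r j = trans (reflexive (≡.cong (λ t → if t ∨ S i then E i j else (B ⊕ X) i j) (dec-false (i ≟ r) i≢r))) (off′ i i≢r j)

      -- Substitute for comparing coefficients: an identity valid at every base point survives
      -- freezing one row, hence, running through the list of rows, freezing any set of them.
      fourRows : FourPoint P U V W Z → ∀ S → FourRows S E U V W Z
      fourRows four S = fourRows-≗ (λ i → full i (member id i)) (partly (allFin n))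
        where
        member? : List (Fin n) → Fin n → Bool
        member? []       i = false
        member? (r ∷ rs) i = does (i ≟ r) ∨ member? rs i
        member : ∀ {m} (f : Fin m → Fin n) i → member? (tabulate f) (f i) ≡ true
        member f zero rewrite dec-true (f zero ≟ f zero) ≡.refl = ≡.refl
        member f (suc i) with f (suc i) ≟ f zero
        ... | yes _ = ≡.refl
        ... | no _  = member (f ∘ suc) i
        part : List (Fin n) → Fin n → Bool
        part rs i = member? rs i ∧ S i
        full : ∀ i → member? (allFin n) i ≡ true → part (allFin n) i ≡ S i
        full i eq rewrite eq = ≡.refl
        partly : ∀ rs → FourRows (part rs) E U V W Z
        partly [] = four
        partly (r ∷ rs) with S r in Sr
        ... | true  = fourRows-≗ more (fourRows-insert r {part rs} (partly rs))
          where
          more : ∀ i → insert r (part rs) i ≡ part (r ∷ rs) i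
          more i with i ≟ r
          ... | yes ≡.refl rewrite Sr = ≡.refl
          ... | no _ = ≡.refl
        ... | false = fourRows-≗ same (partly rs)
          where
          same : ∀ i → part rs i ≡ part (r ∷ rs) i
          same i with i ≟ r
          ... | yes ≡.refl rewrite Sr with member? rs r
          ... | true  = ≡.refl
          ... | false = ≡.refl
          same i | no _ = ≡.refl

    -- Along each permutation at most one entry of `Y` is nonzero, so every product is affine in the
    -- direction `Y`. A matrix on a row satisfies this, and so does one on a column.
    flat-line : ∀ {Y : Matrix n} → (∀ σ → Inj σ → ∃ λ a → ∀ i → i ≢ a → Y i (σ i) ≈ 0#) → Flat (P) Y
    flat-line {Y} thin B = begin
      P (B ⊕ (Y ⊕ Y)) + P (B ⊕ O)   ≈⟨ +-cong (expand (B ⊕ (Y ⊕ Y))) (expand (B ⊕ O)) ⟩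
      ∑ᶠ (term (B ⊕ (Y ⊕ Y))) + ∑ᶠ (term (B ⊕ O))  ≈⟨ ∑-+ (term (B ⊕ (Y ⊕ Y))) (term (B ⊕ O)) (allFunctions n n) ⟩
      ∑ᶠ (λ σ → term (B ⊕ (Y ⊕ Y)) σ + term (B ⊕ O) σ)  ≈⟨ ∑-cong (allFunctions n n) each ⟩
      ∑ᶠ (λ σ → term (B ⊕ Y) σ + term (B ⊕ Y) σ)  ≈⟨ ∑-+ (term (B ⊕ Y)) (term (B ⊕ Y)) (allFunctions n n) ⟨
      ∑ᶠ (term (B ⊕ Y)) + ∑ᶠ (term (B ⊕ Y))  ≈⟨ +-cong (expand (B ⊕ Y)) (expand (B ⊕ Y)) ⟨
      P (B ⊕ Y) + P (B ⊕ Y)       ∎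
      where
      affine : ∀ {m} (a : Fin m) {b y : Fin m → K} → (∀ i → i ≢ a → y i ≈ 0#) →
               prod (λ i → b i + (y i + y i)) + prod (λ i → b i + 0#) ≈ prod (λ i → b i + y i) + prod (λ i → b i + y i)
      affine {suc m} a {b} {y} zeros = begin
        _  ≈⟨ +-cong (pull (λ t → t + t) (λ t≈0 → trans (+-cong t≈0 t≈0) (+-identityˡ 0#))) (pull (λ _ → 0#) (λ _ → refl)) ⟩
        (b a + (y a + y a)) * rest + (b a + 0#) * rest
           ≈⟨ solve 3 (λ b y r → (b :+ (y :+ y)) :* r :+ (b :+ con 0) :* r := (b :+ y) :* r :+ (b :+ y) :* r) refl (b a) (y a) rest ⟩
        (b a + y a) * rest + (b a + y a) * rest  ≈⟨ +-cong (pull id id) (pull id id) ⟨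
        _  ∎
        where
        rest = prod (λ i → b (punchIn a i))
        pull : ∀ (g : K → K) → (∀ {t} → t ≈ 0# → g t ≈ 0#) → prod (λ i → b i + g (y i)) ≈ (b a + g (y a)) * rest
        pull g g0 = trans (∏Sum.sum-remove {i = a} (λ i → b i + g (y i)))
          (*-congˡ (∏Sum.sum-cong-≋ λ i → trans (+-congˡ (g0 (zeros _ (punchInᵢ≢i a i)))) (+-identityʳ _)))
      each : ∀ σ → term (B ⊕ (Y ⊕ Y)) σ + term (B ⊕ O) σ ≈ term (B ⊕ Y) σ + term (B ⊕ Y) σ
      each σ with injective? σ
      ... | no ¬inj = trans (+-cong (null (B ⊕ (Y ⊕ Y))) (null (B ⊕ O))) (sym (+-cong (null (B ⊕ Y)) (null (B ⊕ Y))))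
        where
        null : ∀ X → term X σ ≈ 0#
        null X = trans (*-congʳ (weight-zero ¬inj)) (zeroˡ _)
      ... | yes inj with thin σ inj
      ... | a , zeros = trans (sym (distribˡ (weight σ) _ _))
                       (trans (*-congˡ (affine a {λ i → B i (σ i)} zeros)) (distribˡ (weight σ) _ _))

  -- Relations for flat matrices over a field of characteristic zero.

  module Division (isField : IsField) (charZero : CharZero) where
    inverse : ∀ x → ¬ x ≈ 0# → ∃ λ y → x * y ≈ 1#
    inverse = proj₂ isField

    cancel-zero : ∀ {x y} → ¬ x ≈ 0# → x * y ≈ 0# → y ≈ 0#
    cancel-zero {x} {y} x≉0 xy≈0 with inverse x x≉0
    ... | x⁻¹ , xx⁻¹≈1 = begin
      y                ≈⟨ *-identityˡ y ⟨
      1# * y           ≈⟨ *-congʳ xx⁻¹≈1 ⟨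
      x * x⁻¹ * y      ≈⟨ solve 3 (λ x i y → x :* i :* y := i :* (x :* y)) refl x x⁻¹ y ⟩
      x⁻¹ * (x * y)    ≈⟨ *-congˡ xy≈0 ⟩
      x⁻¹ * 0#         ≈⟨ zeroʳ x⁻¹ ⟩
      0#               ∎

    *-≉0 : ∀ {x y} → ¬ x ≈ 0# → ¬ y ≈ 0# → ¬ x * y ≈ 0#
    *-≉0 x≉0 y≉0 xy≈0 = y≉0 (cancel-zero x≉0 xy≈0)

    *-cancel : ∀ {x y z} → ¬ x ≈ 0# → x * y ≈ x * z → y ≈ z
    *-cancel {x} {y} {z} x≉0 xy≈xz with inverse x x≉0
    ... | x⁻¹ , xx⁻¹≈1 = begin
      y                ≈⟨ unit y ⟩
      x⁻¹ * (x * y)    ≈⟨ *-congˡ xy≈xz ⟩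
      x⁻¹ * (x * z)    ≈⟨ unit z ⟨
      z                ∎
      where
      unit : ∀ t → t ≈ x⁻¹ * (x * t)
      unit t = begin
        t              ≈⟨ *-identityˡ t ⟨
        1# * t         ≈⟨ *-congʳ xx⁻¹≈1 ⟨
        x * x⁻¹ * t    ≈⟨ solve 3 (λ x i y → x :* i :* y := i :* (x :* y)) refl x x⁻¹ t ⟩
        x⁻¹ * (x * t)  ∎

    halve : ∀ {x} → x + x ≈ 0# → x ≈ 0#
    halve {x} 2x≈0 = cancel-zero {1# + (1# + 0#)} (charZero 1)
      (trans (solve 1 (λ x → (con 1 :+ (con 1 :+ con 0)) :* x := x :+ x) refl x) 2x≈0)

    ^-≉0 : ∀ {x} → ¬ x ≈ 0# → ∀ k → ¬ x ^ k ≈ 0#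
    ^-≉0 x≉0 zero    = proj₁ isField
    ^-≉0 {x} x≉0 (suc k) = *-≉0 {x} {x ^ k} x≉0 (^-≉0 x≉0 k)

    module _ (q : K) (q≉0 : ¬ q ≈ 0#) {n : ℕ} where
      open QPermanent q {n}

      weight-≉0 : ∀ {σ} → Inj σ → ¬ weight σ ≈ 0#
      weight-≉0 {σ} inj w≈0 = ^-≉0 q≉0 (inversions σ) (trans (sym (weight-injective inj)) w≈0)

      module _ {a b : Fin n} (a≢b : a ≢ b) {σ : Fin n → Fin n} (inj : Inj σ) where
        -- A weighted permanent of the minor of `Y` in rows `a`, `b` and columns `σ a`, `σ b`.
        quadric : Matrix n → K
        quadric Y = weight σ * (Y a (σ a) * Y b (σ b)) + weight (σ ∘ transpose a b) * (Y a (σ b) * Y b (σ a))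

        private
          G : Matrix n → K
          G X = P (replaceRows (others a≢b) (λ i → δ (σ i)) X)

          G-quadric : ∀ X → G X ≈ quadric X
          G-quadric = P-two-rows a≢b inj

        -- Freeze all rows but `a`, `b` and take the base point zero. The value `v` of the quadratic
        -- form at `Y` is 4v at 2Y, so a vanishing second difference says 4v = 2v.
        flat⇒quadric : ∀ {Y} → Flat P Y → quadric Y ≈ 0#
        flat⇒quadric {Y} flat = halve (+-cancelˡ (v + v) _ _ (begin
          v + v + (v + v)
            ≈⟨ solve 6 (λ w w′ p r s t → let v = w :* (p :* r) :+ w′ :* (s :* t) in
                 v :+ v :+ (v :+ v) := (w :* ((con 0 :+ (p :+ p)) :* (con 0 :+ (r :+ r))) :+ w′ :* ((con 0 :+ (s :+ s)) :* (con 0 :+ (t :+ t))))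
                                    :+ (w :* ((con 0 :+ con 0) :* (con 0 :+ con 0)) :+ w′ :* ((con 0 :+ con 0) :* (con 0 :+ con 0))))
                 refl (weight σ) (weight (σ ∘ transpose a b)) (Y a (σ a)) (Y b (σ b)) (Y a (σ b)) (Y b (σ a)) ⟩
          quadric (O ⊕ (Y ⊕ Y)) + quadric (O ⊕ O)  ≈⟨ +-cong (G-quadric (O ⊕ (Y ⊕ Y))) (G-quadric (O ⊕ O)) ⟨
          G (O ⊕ (Y ⊕ Y)) + G (O ⊕ O)              ≈⟨ fourRows (λ i → δ (σ i)) (Y ⊕ Y) O Y Y flat (others a≢b) O ⟩
          G (O ⊕ Y) + G (O ⊕ Y)                    ≈⟨ +-cong (G-quadric (O ⊕ Y)) (G-quadric (O ⊕ Y)) ⟩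
          quadric (O ⊕ Y) + quadric (O ⊕ Y)
            ≈⟨ solve 6 (λ w w′ p r s t →
                 let u = w :* ((con 0 :+ p) :* (con 0 :+ r)) :+ w′ :* ((con 0 :+ s) :* (con 0 :+ t))
                     v = w :* (p :* r) :+ w′ :* (s :* t)
                 in  u :+ u := v :+ v :+ con 0)
                 refl (weight σ) (weight (σ ∘ transpose a b)) (Y a (σ a)) (Y b (σ b)) (Y a (σ b)) (Y b (σ a)) ⟩
          v + v + 0#                               ∎))
          where v = quadric Y

        -- Invariance implies flatness, so the quadratic part at `Y` vanishes. The base point `B`
        -- with a single entry 1 at row `b`, column `σ b` then isolates the linear part, a nonzero
        -- multiple of `Y a (σ a)`.
        invariant⇒zero : ∀ {Y} → (∀ B → P (B ⊕ Y) ≈ P B) → Y a (σ a) ≈ 0#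
        invariant⇒zero {Y} inv = cancel-zero (weight-≉0 inj) (begin
          weight σ * Y a (σ a)  ≈⟨ +-identityʳ _ ⟨
          weight σ * Y a (σ a) + 0#  ≈⟨ +-congˡ (flat⇒quadric flat) ⟨
          weight σ * Y a (σ a) + quadric Y
            ≈⟨ solve 6 (λ w w′ p r s t →
                 w :* p :+ (w :* (p :* r) :+ w′ :* (s :* t)) :=
                 w :* ((con 0 :+ p) :* (con 1 :+ r)) :+ w′ :* ((con 0 :+ s) :* (con 0 :+ t)))
                 refl (weight σ) (weight (σ ∘ transpose a b)) (Y a (σ a)) (Y b (σ b)) (Y a (σ b)) (Y b (σ a)) ⟩
          _  ≈⟨ +-cong (*-congˡ (*-cong (+-congʳ B-aa) (+-congʳ B-bb))) (*-congˡ (*-cong (+-congʳ B-ab) (+-congʳ B-ba))) ⟨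
          quadric (B ⊕ Y)       ≈⟨ G-quadric (B ⊕ Y) ⟨
          G (B ⊕ Y)             ≈⟨ four ⟩
          G (B ⊕ O)             ≈⟨ G-quadric (B ⊕ O) ⟩
          quadric (B ⊕ O)
            ≈⟨ +-cong (*-congˡ (*-congʳ (+-congʳ B-aa))) (*-congˡ (*-congʳ (+-congʳ B-ab))) ⟩
          _  ≈⟨ solve 4 (λ w w′ x y → w :* ((con 0 :+ con 0) :* x) :+ w′ :* ((con 0 :+ con 0) :* y) := con 0)
                 refl (weight σ) (weight (σ ∘ transpose a b)) (B b (σ b) + 0#) (B b (σ a) + 0#) ⟩
          0#                    ∎)
          where
          ⊕-O : ∀ X → P X ≈ P (X ⊕ O)
          ⊕-O X = P-cong λ i j → sym (+-identityʳ _)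
          flat : Flat P Y
          flat B = +-cong (trans (P-cong λ i j → sym (+-assoc _ _ _)) (inv (B ⊕ Y)))
                          (trans (sym (⊕-O B)) (sym (inv B)))
          B : Matrix n
          B i j = if does (i ≟ b) then δ (σ i) j else 0#
          B-row : ∀ j → B b j ≈ δ (σ b) j
          B-row j rewrite dec-true (b ≟ b) ≡.refl = refl
          B-zero : ∀ j → B a j ≈ 0#
          B-zero j rewrite dec-false (a ≟ b) a≢b = refl
          B-aa = B-zero (σ a)
          B-ab = B-zero (σ b)
          B-bb = trans (B-row (σ b)) (δ-refl (σ b))
          B-ba = trans (B-row (σ a)) (δ-≢ {i = σ b} {σ a} (a≢b ∘ ≡.sym ∘ inj))
          four : G (B ⊕ Y) ≈ G (B ⊕ O)
          four = +-cancelʳ (G (B ⊕ O)) _ _ (fourRows (λ i → δ (σ i)) Y O O O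
            (λ B → +-congʳ (trans (inv B) (⊕-O B))) (others a≢b) B)

-- Allows finitely many undecidable questions, such as which entries vanish, to be settled at once
-- inside the proof of a negation.
¬¬∀ : ∀ {n p} {Q : Fin n → Set p} → (∀ i → ¬ ¬ Q i) → ¬ ¬ (∀ i → Q i)
¬¬∀ {zero}  _ k = k λ ()
¬¬∀ {suc n} f k = f zero λ q₀ → ¬¬∀ (f ∘ suc) λ qs → k λ { zero → q₀ ; (suc i) → qs i }

rearranges-unique : ∀ {n} {σ τ ρ : Fin n → Fin n} {a b c x y z} →
  Rearranges σ a b c x y z τ → Rearranges σ a b c x y z ρ → τ ≗ ρ
rearranges-unique {a = a} {b} {c} A B s with s ≟ a | s ≟ b | s ≟ c
... | yes ≡.refl | _ | _ = ≡.trans (Rearranges.at₁ A) (≡.sym (Rearranges.at₁ B))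
... | _ | yes ≡.refl | _ = ≡.trans (Rearranges.at₂ A) (≡.sym (Rearranges.at₂ B))
... | _ | _ | yes ≡.refl = ≡.trans (Rearranges.at₃ A) (≡.sym (Rearranges.at₃ B))
... | no s≢a | no s≢b | no s≢c =
  ≡.trans (Rearranges.off A s s≢a s≢b s≢c) (≡.sym (Rearranges.off B s s≢a s≢b s≢c))

-- Brings the row pairs `b`, `c` and `c`, `a` into the position of `a`, `b`.
rearranges-cycle : ∀ {n} {σ τ : Fin n → Fin n} {a b c x y z} →
  Rearranges σ a b c x y z τ → Rearranges σ b c a y z x τ
rearranges-cycle (rearranges p q r off) = rearranges q r p λ s s≢b s≢c s≢a → off s s≢a s≢b s≢c

rearranges-transpose : ∀ {n} {σ τ : Fin n → Fin n} {a b c x y z} → a ≢ c → b ≢ c →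
  Rearranges σ a b c x y z τ → Rearranges σ a b c y x z (τ ∘ transpose a b)
rearranges-transpose {τ = τ} {a} {b} {c} a≢c b≢c (rearranges p q r off) = rearranges
  (≡.trans (≡.cong τ (transpose-left a b)) q)
  (≡.trans (≡.cong τ (transpose-right a b)) p)
  (≡.trans (≡.cong τ (transpose-other a b (≡.≢-sym a≢c) (≡.≢-sym b≢c))) r)
  λ s s≢a s≢b s≢c → ≡.trans (≡.cong τ (transpose-other a b s≢a s≢b)) (off s s≢a s≢b s≢c)

-- Hexagon relations, and linear algebra up to double negation.

module Algebraic {c ℓ : Level} (R : CommutativeRing c ℓ) (isField : Over.IsField R) (charZero : Over.CharZero R) where
  open Field R public
  open Division isField charZero public
  open Mult semiring using (×-homo-+) renaming (_×_ to _·_)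

  zero? : ∀ x → ¬ ¬ Dec (x ≈ 0#)
  zero? x = ¬¬-excluded-middle

  module Hexagonal (q : K) (q≉0 : ¬ q ≈ 0#) {n : ℕ} where
    open QPermanent q {n}

    AllInjective : (e₀ e₁ e₂ o₀ o₁ o₂ : Fin n → Fin n) → Set
    AllInjective e₀ e₁ e₂ o₀ o₁ o₂ = (Inj e₀ × Inj e₁ × Inj e₂) × (Inj o₀ × Inj o₁ × Inj o₂)

    -- Inversion counts become exponents of `q`. The disjunction stays because the orders of the
    -- rows and of the values decide which parity has more inversions.
    hexagon-weights : ∀ {a b c x y z e₀ e₁ e₂ o₀ o₁ o₂} → Hexagon a b c x y z e₀ e₁ e₂ o₀ o₁ o₂ →
      AllInjective e₀ e₁ e₂ o₀ o₁ o₂ →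
      let E = weight e₀ * weight e₁ * weight e₂
          O = weight o₀ * weight o₁ * weight o₂
      in  E ≈ q * O ⊎ O ≈ q * E
    hexagon-weights {e₀ = e₀} {e₁} {e₂} {o₀} {o₁} {o₂} hex ((ie₀ , ie₁ , ie₂) , (io₀ , io₁ , io₂)) =
      case hexagon-inversions hex of λ where
        (inj₁ eq) → inj₁ (shift eq (product ie₀ ie₁ ie₂) (product io₀ io₁ io₂))
        (inj₂ eq) → inj₂ (shift eq (product io₀ io₁ io₂) (product ie₀ ie₁ ie₂))
      where
      product : ∀ {σ τ ρ} → Inj σ → Inj τ → Inj ρ →
        weight σ * weight τ * weight ρ ≈ q ^ (inversions σ ℕ.+ inversions τ ℕ.+ inversions ρ)
      product {σ} {τ} {ρ} iσ iτ iρ = begin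
        weight σ * weight τ * weight ρ
          ≈⟨ *-cong (*-cong (weight-injective iσ) (weight-injective iτ)) (weight-injective iρ) ⟩
        q ^ inversions σ * q ^ inversions τ * q ^ inversions ρ
          ≈⟨ *-congʳ (^-homo-* q (inversions σ) (inversions τ)) ⟨
        q ^ (inversions σ ℕ.+ inversions τ) * q ^ inversions ρ
          ≈⟨ ^-homo-* q (inversions σ ℕ.+ inversions τ) (inversions ρ) ⟨
        q ^ (inversions σ ℕ.+ inversions τ ℕ.+ inversions ρ) ∎
      shift : ∀ {k l x y} → k ≡ suc l → x ≈ q ^ k → y ≈ q ^ l → x ≈ q * y
      shift ≡.refl x≈ y≈ = trans x≈ (*-congˡ (sym y≈))

    quadric-relation : ∀ {a b u v τ τ′} → a ≢ b → Inj τ → τ a ≡ u → τ b ≡ v → τ′ ≗ τ ∘ transpose a b →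
      ∀ {Y} → Flat P Y → weight τ * (Y a u * Y b v) + weight τ′ * (Y a v * Y b u) ≈ 0#
    quadric-relation {a} {b} {τ = τ} a≢b inj ≡.refl ≡.refl τ′≗ {Y} flat =
      trans (+-congˡ (*-congʳ (weight-ext τ′≗))) (flat⇒quadric q q≉0 a≢b inj {Y} flat)

    -- For arguments on a single minor it suffices that both coefficients are nonzero; the
    -- completing permutation is forgotten.
    minor-relation : ∀ {a b k l} → a ≢ b → k ≢ l → ∃ λ α → ∃ λ β → (¬ α ≈ 0#) × (¬ β ≈ 0#) ×
      (∀ {Y} → Flat P Y → α * (Y a k * Y b l) + β * (Y a l * Y b k) ≈ 0#)
    minor-relation {a} {b} a≢b k≢l with injection-through₂ a≢b k≢l
    ... | σ , inj , σa , σb =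
      weight σ , weight (σ ∘ transpose a b) , weight-≉0 q q≉0 inj ,
      weight-≉0 q q≉0 (λ eq → transpose-injective a b (inj eq)) ,
      quadric-relation a≢b inj σa σb (λ _ → ≡.refl)

    -- Multiplying the relations α uᵢ = - β vᵢ.
    triple : ∀ {α₁ α₂ α₃ β₁ β₂ β₃ u₁ u₂ u₃ v₁ v₂ v₃} → ¬ 1# + q ≈ 0# →
      let A = α₁ * α₂ * α₃
          B = β₁ * β₂ * β₃
      in  ¬ A ≈ 0# → ¬ B ≈ 0# → A ≈ q * B ⊎ B ≈ q * A →
          α₁ * u₁ + β₁ * v₁ ≈ 0# → α₂ * u₂ + β₂ * v₂ ≈ 0# → α₃ * u₃ + β₃ * v₃ ≈ 0# →
          u₁ * u₂ * u₃ ≈ v₁ * v₂ * v₃ → u₁ * u₂ * u₃ ≈ 0#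
    triple {α₁} {α₂} {α₃} {β₁} {β₂} {β₃} {u₁} {u₂} {u₃} {v₁} {v₂} {v₃} 1+q≉0 A≉0 B≉0 ratio eq₁ eq₂ eq₃ u≈v =
      case ratio of λ where
        (inj₁ A≈qB) → cancel-zero B≉0 (cancel-zero 1+q≉0 (begin
          (1# + q) * (B * u)  ≈⟨ solve 3 (λ q B u → (con 1 :+ q) :* (B :* u) := (q :* B) :* u :+ B :* u) refl q B u ⟩
          q * B * u + B * u   ≈⟨ +-cong (*-congʳ A≈qB) (*-congˡ (sym u≈v)) ⟨
          A * u + B * v       ≈⟨ sum-zero ⟩
          0#                  ∎))
        (inj₂ B≈qA) → cancel-zero A≉0 (cancel-zero 1+q≉0 (begin
          (1# + q) * (A * u)  ≈⟨ solve 3 (λ q A u → (con 1 :+ q) :* (A :* u) := A :* u :+ (q :* A) :* u) refl q A u ⟩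
          A * u + q * A * u   ≈⟨ +-congˡ (*-cong B≈qA (sym u≈v)) ⟨
          A * u + B * v       ≈⟨ sum-zero ⟩
          0#                  ∎))
      where
      A = α₁ * α₂ * α₃
      B = β₁ * β₂ * β₃
      u = u₁ * u₂ * u₃
      v = v₁ * v₂ * v₃
      -- Three is odd, so p_i = - r_i makes the two products opposite. Adding the vanishing
      -- `(p₂ + r₂) * (r₁ * p₃)` lets semiring identities prove this.
      telescope : ∀ {p₁ p₂ p₃ r₁ r₂ r₃} → p₁ + r₁ ≈ 0# → p₂ + r₂ ≈ 0# → p₃ + r₃ ≈ 0# → p₁ * p₂ * p₃ + r₁ * r₂ * r₃ ≈ 0#
      telescope {p₁} {p₂} {p₃} {r₁} {r₂} {r₃} e₁ e₂ e₃ = begin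
        p₁ * p₂ * p₃ + r₁ * r₂ * r₃                      ≈⟨ +-identityʳ _ ⟨
        p₁ * p₂ * p₃ + r₁ * r₂ * r₃ + 0#                 ≈⟨ +-congˡ (trans (*-congʳ e₂) (zeroˡ _)) ⟨
        p₁ * p₂ * p₃ + r₁ * r₂ * r₃ + (p₂ + r₂) * (r₁ * p₃)
          ≈⟨ solve 6 (λ p₁ p₂ p₃ r₁ r₂ r₃ → p₁ :* p₂ :* p₃ :+ r₁ :* r₂ :* r₃ :+ (p₂ :+ r₂) :* (r₁ :* p₃) :=
                        (p₁ :+ r₁) :* (p₂ :* p₃) :+ (p₃ :+ r₃) :* (r₁ :* r₂)) refl p₁ p₂ p₃ r₁ r₂ r₃ ⟩
        (p₁ + r₁) * (p₂ * p₃) + (p₃ + r₃) * (r₁ * r₂)    ≈⟨ +-cong (*-congʳ e₁) (*-congʳ e₃) ⟩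
        0# * (p₂ * p₃) + 0# * (r₁ * r₂)                  ≈⟨ +-cong (zeroˡ _) (zeroˡ _) ⟩
        0# + 0#                                          ≈⟨ +-identityˡ 0# ⟩
        0#                                               ∎
      spread : ∀ x₁ x₂ x₃ y₁ y₂ y₃ → x₁ * x₂ * x₃ * (y₁ * y₂ * y₃) ≈ x₁ * y₁ * (x₂ * y₂) * (x₃ * y₃)
      spread = solve 6 (λ x₁ x₂ x₃ y₁ y₂ y₃ → x₁ :* x₂ :* x₃ :* (y₁ :* y₂ :* y₃) := x₁ :* y₁ :* (x₂ :* y₂) :* (x₃ :* y₃)) refl
      sum-zero : A * u + B * v ≈ 0#
      sum-zero = trans (+-cong (spread α₁ α₂ α₃ u₁ u₂ u₃) (spread β₁ β₂ β₃ v₁ v₂ v₃)) (telescope eq₁ eq₂ eq₃)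

    module _ (1+q≉0 : ¬ 1# + q ≈ 0#) {a b c x y z : Fin n} (a≢b : a ≢ b) (a≢c : a ≢ c) (b≢c : b ≢ c)
             (x≢y : x ≢ y) (x≢z : x ≢ z) (y≢z : y ≢ z) where
      private
        module Six {σ : Fin n → Fin n} (inj : Inj σ) where
          j₀ : Inj (σ ∘ transpose a b)
          j₀ eq = transpose-injective a b (inj eq)
          j₁ : Inj (σ ∘ transpose b c)
          j₁ eq = transpose-injective b c (inj eq)
          j₂ : Inj (σ ∘ transpose a c)
          j₂ eq = transpose-injective a c (inj eq)
          i₁ : Inj (σ ∘ transpose a b ∘ transpose b c)
          i₁ eq = transpose-injective b c (j₀ eq)
          i₂ : Inj (σ ∘ transpose b c ∘ transpose a b)
          i₂ eq = transpose-injective a b (j₁ eq)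

        w₃≉0 : ∀ {σ τ ρ} → Inj σ → Inj τ → Inj ρ → ¬ weight σ * weight τ * weight ρ ≈ 0#
        w₃≉0 iσ iτ iρ = *-≉0 (*-≉0 (weight-≉0 q q≉0 iσ) (weight-≉0 q q≉0 iτ)) (weight-≉0 q q≉0 iρ)

        ratio-cong : ∀ {E E′ O O′} → E ≈ E′ → O ≈ O′ → E ≈ q * O ⊎ O ≈ q * E → E′ ≈ q * O′ ⊎ O′ ≈ q * E′
        ratio-cong E≈ O≈ (inj₁ eq) = inj₁ (trans (sym E≈) (trans eq (*-congˡ O≈)))
        ratio-cong E≈ O≈ (inj₂ eq) = inj₂ (trans (sym O≈) (trans eq (*-congˡ E≈)))

        swap : ∀ u v w → u * v * w ≈ u * w * v
        swap = solve 3 (λ u v w → u :* v :* w := u :* w :* v) refl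

      -- Take the minors of rows `a`, `b` in columns xy, yz, zx, with row `c` receiving the value
      -- left over. Their diagonals and their antidiagonals run through the same six entries, and
      -- their weights form a hexagon.
      two-rows : ∀ {Y} → Flat P Y → Y a x * Y b y * (Y a y * Y b z) * (Y a z * Y b x) ≈ 0#
      two-rows {Y} flat with hexagon-through a≢b a≢c b≢c x≢y x≢z y≢z
      ... | σ , inj , hex =
        triple 1+q≉0 (w₃≉0 inj i₁ i₂) (w₃≉0 j₀ j₂ j₁)
          -- Exchanging the values at `a` and `b` pairs `E₁` with `O₂` and `E₂` with `O₁`.
          (ratio-cong refl (swap _ _ _) (hexagon-weights hex ((inj , i₁ , i₂) , (j₀ , j₁ , j₂))))
          (quadric-relation a≢b inj (at₁ E₀) (at₂ E₀) (rearranges-unique O₀ (rearranges-transpose a≢c b≢c E₀)) flat)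
          (quadric-relation a≢b i₁ (at₁ E₁) (at₂ E₁) (rearranges-unique O₂ (rearranges-transpose a≢c b≢c E₁)) flat)
          (quadric-relation a≢b i₂ (at₁ E₂) (at₂ E₂) (rearranges-unique O₁ (rearranges-transpose a≢c b≢c E₂)) flat)
          (solve 6 (λ ax ay az bx by bz → ax :* by :* (ay :* bz) :* (az :* bx) := ay :* bx :* (az :* by) :* (ax :* bz)) refl
            (Y a x) (Y a y) (Y a z) (Y b x) (Y b y) (Y b z))
        where
        open Hexagon hex using (E₀; E₁; E₂; O₀; O₁; O₂)
        open Rearranges
        open Six inj

      -- As for two rows, with the row pairs ab, bc, ca in columns `x`, `y`. The row left out takes
      -- the value `z`, which only completes the hexagon.
      two-columns : ∀ {Y} → Flat P Y → Y a x * Y b y * (Y b x * Y c y) * (Y c x * Y a y) ≈ 0#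
      two-columns {Y} flat with hexagon-through a≢b a≢c b≢c x≢y x≢z y≢z
      ... | σ , inj , hex =
        triple 1+q≉0 (w₃≉0 inj i₂ i₁) (w₃≉0 j₀ j₂ j₁)
          (ratio-cong (swap _ _ _) (swap _ _ _) (hexagon-weights hex ((inj , i₁ , i₂) , (j₀ , j₁ , j₂))))
          (quadric-relation a≢b inj (at₁ E₀) (at₂ E₀) (rearranges-unique O₀ (rearranges-transpose a≢c b≢c E₀)) flat)
          (quadric-relation b≢c i₂ (at₂ E₂) (at₃ E₂)
            (rearranges-unique (rearranges-cycle O₂) (rearranges-transpose (≡.≢-sym a≢b) (≡.≢-sym a≢c) (rearranges-cycle E₂))) flat)
          (quadric-relation (≡.≢-sym a≢c) i₁ (at₃ E₁) (at₁ E₁)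
            (rearranges-unique (rearranges-cycle (rearranges-cycle O₁))
              (rearranges-transpose (≡.≢-sym b≢c) a≢b (rearranges-cycle (rearranges-cycle E₁)))) flat)
          (solve 6 (λ ax bx cx ay by cy → ax :* by :* (bx :* cy) :* (cx :* ay) := ay :* bx :* (by :* cx) :* (cy :* ax)) refl
            (Y a x) (Y b x) (Y c x) (Y a y) (Y b y) (Y c y))
        where
        open Hexagon hex using (E₀; E₁; E₂; O₀; O₁; O₂)
        open Rearranges
        open Six inj

  -- Gaussian elimination on the first coordinate. The double negation pays for the search of a
  -- pivot.
  dependent : ∀ {M N} → M < N → (v : Fin N → Fin M → K) →
    ¬ ¬ ∃ λ (x : Fin N → K) → (∃ λ i → ¬ x i ≈ 0#) × (∀ j → sum (λ i → x i * v i j) ≈ 0#)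
  dependent {zero}  {suc N} _ v k = k ((λ _ → 1#) , (zero , proj₁ isField) , λ ())
  dependent {suc M} {suc N} (s≤s M<N) v k = ¬¬∀ (λ i → zero? (v i zero)) λ zeros → case all? zeros of λ where
      (yes none) → dependent (ℕₚ.m<n⇒m<1+n M<N) (λ i j → v i (suc j)) λ (x , nonzero , eqs) →
        k (x , nonzero , λ { zero → ∑-few.sum-ε (λ i → trans (*-congˡ {x i} (none i)) (zeroʳ _)) ; (suc j) → eqs j })
      (no some) → pivot (¬∀⟶∃¬ (suc N) _ zeros some)
    where
    pivot : (∃ λ p → ¬ v p zero ≈ 0#) → ⊥
    pivot (p , u≉0) = dependent M<N v′ λ (x′ , (i , x′i≉0) , eqs) → k
      ( solution x′
      , (punchIn p i , λ eq → *-≉0 u≉0 x′i≉0 (trans (sym (reflexive (insertAt-punchIn (λ i → u * x′ i) p _ i))) eq))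
      , λ j → begin
          sum (λ i → solution x′ i * v i j)  ≈⟨ MonoidSum.sum-remove +-commutativeMonoid {i = p} (λ i → solution x′ i * v i j) ⟩
          _  ≈⟨ +-cong (*-congʳ (reflexive (insertAt-lookup _ p _)))
                       (sum-cong-≋ λ i → *-congʳ (reflexive (insertAt-punchIn (λ i → u * x′ i) p _ i))) ⟩
          coefficient x′ * v p j + sum (λ i → u * x′ i * v (punchIn p i) j)
             ≈⟨ +-congʳ (*-distribʳ-sum (v p j) (λ i → x′ i * - v (punchIn p i) zero)) ⟩
          sum (λ i → x′ i * - v (punchIn p i) zero * v p j) + sum (λ i → u * x′ i * v (punchIn p i) j)
             ≈⟨ ∑-distrib-+ (λ i → x′ i * - v (punchIn p i) zero * v p j) (λ i → u * x′ i * v (punchIn p i) j) ⟨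
          sum (λ i → x′ i * - v (punchIn p i) zero * v p j + u * x′ i * v (punchIn p i) j)
             ≈⟨ column x′ eqs j ⟩
          0# ∎)
      where
      u = v p zero
      -- Elimination without division: vectors are scaled by the pivot `u`, and since `u` is nonzero
      -- a nontrivial solution for `v′` stays nontrivial when pulled back.
      v′ : Fin N → Fin M → K
      v′ i j = - v (punchIn p i) zero * v p (suc j) + u * v (punchIn p i) (suc j)
      coefficient : (Fin N → K) → K
      coefficient x′ = sum (λ i → x′ i * - v (punchIn p i) zero)
      solution : (Fin N → K) → Fin (suc N) → K
      solution x′ = insertAt (λ i → u * x′ i) p (coefficient x′)
      column : ∀ x′ → (∀ j → sum (λ i → x′ i * v′ i j) ≈ 0#) → ∀ j →
        sum (λ i → x′ i * - v (punchIn p i) zero * v p j + u * x′ i * v (punchIn p i) j) ≈ 0#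
      column x′ eqs zero = ∑-few.sum-ε λ i → begin
        x′ i * - v (punchIn p i) zero * u + u * x′ i * v (punchIn p i) zero
          ≈⟨ solve 4 (λ x m u w → x :* m :* u :+ u :* x :* w := x :* u :* (m :+ w)) refl (x′ i) (- v (punchIn p i) zero) u (v (punchIn p i) zero) ⟩
        x′ i * u * (- v (punchIn p i) zero + v (punchIn p i) zero)  ≈⟨ *-congˡ (-‿inverseˡ _) ⟩
        x′ i * u * 0#                                               ≈⟨ zeroʳ _ ⟩
        0#                                                          ∎
      column x′ eqs (suc j) = trans (sum-cong-≋ λ i →
        solve 5 (λ x m r u w → x :* m :* r :+ u :* x :* w := x :* (m :* r :+ u :* w)) refl
          (x′ i) (- v (punchIn p i) zero) (v p (suc j)) u (v (punchIn p i) (suc j))) (eqs j)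

  -- For nonzero `b`, characteristic zero allows at most one natural root t of tb + a; `T` is chosen
  -- just past it.
  avoid : ∀ a b → ¬ ¬ ∃ λ T → ∀ t → T ≤ t → (t · 1#) * b + a ≈ 0# → a ≈ 0# × b ≈ 0#
  avoid a b k = zero? b λ where
      (yes b≈0) → k (0 , λ t _ eq → trans (sym (trans (+-congʳ (trans (*-congˡ b≈0) (zeroʳ _))) (+-identityˡ a))) eq , b≈0)
      (no b≉0) → ¬¬-excluded-middle λ where
        (no never) → k (0 , λ t _ eq → contradiction (t , eq) never)
        (yes (t , eq)) → k (suc t , λ t′ t<t′ eq′ → contradiction (unique t t′ t<t′ eq eq′) b≉0)
    where
    unique : ∀ t t′ → t < t′ → (t · 1#) * b + a ≈ 0# → (t′ · 1#) * b + a ≈ 0# → b ≈ 0#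
    unique t t′ t<t′ eq eq′ with ℕₚ.m≤n⇒∃[o]m+o≡n t<t′
    ... | d , ≡.refl = cancel-zero (charZero d) (begin
      (suc d · 1#) * b                                ≈⟨ +-identityʳ _ ⟨
      (suc d · 1#) * b + 0#                           ≈⟨ +-congˡ eq ⟨
      (suc d · 1#) * b + ((t · 1#) * b + a)           ≈⟨ solve 4 (λ d t b a → d :* b :+ (t :* b :+ a) := (d :+ t) :* b :+ a) refl _ _ b a ⟩
      (suc d · 1# + t · 1#) * b + a                   ≈⟨ +-congʳ (*-congʳ (×-homo-+ 1# (suc d) t)) ⟨
      ((suc d ℕ.+ t) · 1#) * b + a                    ≈⟨ +-congʳ (*-congʳ (reflexive (≡.cong (λ m → suc m · 1#) (ℕₚ.+-comm d t)))) ⟩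
      ((suc t ℕ.+ d) · 1#) * b + a                    ≈⟨ eq′ ⟩
      0#                                              ∎)

  -- The coefficients are natural numbers, each chosen large enough to avoid all new cancellations.
  generic : ∀ {m N} (v : Fin m → Fin N → K) →
    ¬ ¬ ∃ λ (x : Fin m → K) → ∀ j → sum (λ i → x i * v i j) ≈ 0# → ∀ i → v i j ≈ 0#
  generic {zero}  v k = k ((λ ()) , λ _ _ ())
  generic {suc m} {N} v k = generic (v ∘ suc) λ (x , x-generic) →
    ¬¬∀ (λ j → avoid (sum (λ i → x i * v (suc i) j)) (v zero j)) λ bounds →
    -- The sum of the bounds is a common upper bound for them.
    let T = ℕSum.sum (λ j → proj₁ (bounds j)) in
    k ( (T · 1#) Vector.∷ x
      , λ j eq → case proj₂ (bounds j) T (≤-sum (λ j → proj₁ (bounds j)) j) eq of λ where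
          (a≈0 , b≈0) → λ { zero → b≈0 ; (suc i) → x-generic j a≈0 i })
    where
    ≤-sum : ∀ {N} (f : Fin N → ℕ) j → f j ≤ ℕSum.sum f
    ≤-sum f zero    = ℕₚ.m≤m+n (f zero) _
    ≤-sum f (suc j) = ℕₚ.≤-trans (≤-sum (f ∘ suc) j) (ℕₚ.m≤n+m _ (f zero))

third : ∀ {m} (a b : Fin (suc (suc (suc m)))) → ∃ λ c → c ≢ a × c ≢ b
third zero          zero          = 1F , (λ ()) , λ ()
third zero          (suc zero)    = 2F , (λ ()) , λ ()
third zero          (suc (suc _)) = 1F , (λ ()) , λ ()
third (suc zero)    zero          = 2F , (λ ()) , λ ()
third (suc (suc _)) zero          = 1F , (λ ()) , λ ()
third (suc _)       (suc _)       = 0F , (λ ()) , λ ()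

-- Supports of flat matrices and of spaces of flat matrices.

module Spaces {c ℓ : Level} (R : CommutativeRing c ℓ) (isField : Over.IsField R) (charZero : Over.CharZero R) where
  open Algebraic R isField charZero public

  combination : ∀ {N n} → (Fin N → Matrix n) → (Fin N → K) → Matrix n
  combination Y x i j = sum (λ p → x p * Y p i j)

  combination-+ : ∀ {N n} (Y : Fin N → Matrix n) x y →
    combination Y (λ p → x p + y p) ≋ (combination Y x ⊕ combination Y y)
  combination-+ Y x y i j = trans (sum-cong-≋ λ p → distribʳ (Y p i j) (x p) (y p))
    (∑-distrib-+ (λ p → x p * Y p i j) (λ p → y p * Y p i j))

  -- `orient false` transposes, so that one argument serves rows and columns. The type `A` is free
  -- because families of matrices are transposed too, not only matrices.
  orient : ∀ {A : Set c} {n} → Bool → (Fin n → Fin n → A) → Fin n → Fin n → A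
  orient true  X i j = X i j
  orient false X i j = X j i

  Line : ℕ → Set
  Line n = Bool × Fin n

  -- (true , r) is the row r, (false , r) the column r.
  OnLine : ∀ {n} → Line n → Matrix n → Set ℓ
  OnLine (b , r) X = ∀ i j → i ≢ r → orient b X i j ≈ 0#

  module FlatMatrices (q : K) (q≉0 : ¬ q ≈ 0#) (1+q≉0 : ¬ 1# + q ≈ 0#) {m : ℕ} where
    n : ℕ
    n = suc (suc (suc m))
    open QPermanent q {n} using (P)
    open Hexagonal q q≉0 {n} using (minor-relation; two-rows; two-columns)

    -- Outside the block entries vanish only up to double negation, since this is obtained by
    -- refuting a nonzero entry.
    record Block (Z : Matrix n) : Set ℓ where
      field
        {i j k l} : Fin n
        i≢j  : i ≢ j
        k≢l  : k ≢ l
        ik≉0 : ¬ Z i k ≈ 0#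
        il≉0 : ¬ Z i l ≈ 0#
        jk≉0 : ¬ Z j k ≈ 0#
        jl≉0 : ¬ Z j l ≈ 0#
        row-zero    : ∀ r → r ≢ i → r ≢ j → ∀ c → ¬ ¬ Z r c ≈ 0#
        column-zero : ∀ c → c ≢ k → c ≢ l → ∀ r → ¬ ¬ Z r c ≈ 0#

    module _ {Z : Matrix n} (flat : Flat P Z) where
      -- In a relation with nonzero coefficients, a nonzero diagonal product forces the other
      -- product to be nonzero.
      square : ∀ {a b k l} → a ≢ b → k ≢ l → ¬ Z a k ≈ 0# → ¬ Z b l ≈ 0# → (¬ Z a l ≈ 0#) × (¬ Z b k ≈ 0#)
      square {a} {b} {k} {l} a≢b k≢l ak bl with minor-relation a≢b k≢l
      ... | α , β , α≉0 , β≉0 , relation =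
        (λ al≈0 → absurd (trans (*-congʳ al≈0) (zeroˡ _))) , (λ bk≈0 → absurd (trans (*-congˡ bk≈0) (zeroʳ _)))
        where
        absurd : ¬ Z a l * Z b k ≈ 0#
        absurd z = *-≉0 α≉0 (*-≉0 ak bl) (begin
          α * (Z a k * Z b l)                        ≈⟨ +-identityʳ _ ⟨
          α * (Z a k * Z b l) + 0#                   ≈⟨ +-congˡ (trans (*-congˡ z) (zeroʳ β)) ⟨
          α * (Z a k * Z b l) + β * (Z a l * Z b k)  ≈⟨ relation {Z} flat ⟩
          0#                                         ∎)

      -- `square` would spread a nonzero entry in a further row or column to a full 3 × 2 or 2 × 3
      -- minor, against `two-columns` or `two-rows`. The auxiliary line of these comes from `third`.
      block : ∀ {i j k l} → i ≢ j → k ≢ l → ¬ Z i k ≈ 0# → ¬ Z j l ≈ 0# → Block Z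
      block {i} {j} {k} {l} i≢j k≢l ik jl = record
        { i≢j = i≢j ; k≢l = k≢l ; ik≉0 = ik ; il≉0 = il ; jk≉0 = jk ; jl≉0 = jl
        ; row-zero = row ; column-zero = column }
        where
        il = proj₁ (square i≢j k≢l ik jl)
        jk = proj₂ (square i≢j k≢l ik jl)
        row : ∀ r → r ≢ i → r ≢ j → ∀ c → ¬ ¬ Z r c ≈ 0#
        row r r≢i r≢j c rc =
          *-≉0 (*-≉0 (*-≉0 ik jl) (*-≉0 jk rl)) (*-≉0 rk il)
            (two-columns 1+q≉0 i≢j (≡.≢-sym r≢i) (≡.≢-sym r≢j) k≢l (proj₁ (proj₂ o)) (proj₂ (proj₂ o)) flat)
          where
          o : ∃ λ z → k ≢ z × l ≢ z
          o = case third k l of λ (z , z≢k , z≢l) → z , ≡.≢-sym z≢k , ≡.≢-sym z≢l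
          rk : ¬ Z r k ≈ 0#
          rk with c ≟ k
          ... | yes ≡.refl = rc
          ... | no c≢k = proj₁ (square r≢i c≢k rc ik)
          rl : ¬ Z r l ≈ 0#
          rl = proj₁ (square r≢i k≢l rk il)
        column : ∀ c → c ≢ k → c ≢ l → ∀ r → ¬ ¬ Z r c ≈ 0#
        column c c≢k c≢l r rc =
          *-≉0 (*-≉0 (*-≉0 ik jl) (*-≉0 il jc)) (*-≉0 ic jk)
            (two-rows 1+q≉0 i≢j (proj₁ (proj₂ o)) (proj₂ (proj₂ o)) k≢l (≡.≢-sym c≢k) (≡.≢-sym c≢l) flat)
          where
          o : ∃ λ z → i ≢ z × j ≢ z
          o = case third i j of λ (z , z≢i , z≢j) → z , ≡.≢-sym z≢i , ≡.≢-sym z≢j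
          ic : ¬ Z i c ≈ 0#
          ic with r ≟ i
          ... | yes ≡.refl = rc
          ... | no r≢i = proj₂ (square r≢i c≢k rc ik)
          jc : ¬ Z j c ≈ 0#
          jc = proj₂ (square i≢j c≢k ic jk)

      -- Off every line there are a nonzero entry, one outside its row and one outside its column.
      -- Two of these three share neither row nor column and span a block.
      support : (∀ i j → Dec (Z i j ≈ 0#)) → (∃ λ L → OnLine L Z) ⊎ Block Z
      support zero? = case any? (λ i → any? λ k → ¬? (zero? i k)) of λ where
        (no none) → inj₁ ((true , 0F) , λ i j _ → decidable-stable (zero? i j) λ ij → none (i , j , ij))
        (yes (i , k , ik)) → case any? (λ j → any? λ l → ¬? (j ≟ i) ×-dec ¬? (zero? j l)) of λ where
          (no none) → inj₁ ((true , i) , λ j l j≢i → decidable-stable (zero? j l) λ jl → none (j , l , j≢i , jl))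
          (yes (j , l , j≢i , jl)) → case any? (λ l′ → any? λ j′ → ¬? (l′ ≟ k) ×-dec ¬? (zero? j′ l′)) of λ where
            (no none) → inj₁ ((false , k) , λ l′ j′ l′≢k → decidable-stable (zero? j′ l′) λ jl → none (l′ , j′ , l′≢k , jl))
            (yes (l′ , j′ , l′≢k , j′l′)) → inj₂ (case l ≟ k of λ where
              (no l≢k) → block (≡.≢-sym j≢i) (≡.≢-sym l≢k) ik jl
              (yes ≡.refl) → case j′ ≟ i of λ where
                (no j′≢i)    → block (≡.≢-sym j′≢i) (≡.≢-sym l′≢k) ik j′l′
                (yes ≡.refl) → block j≢i (≡.≢-sym l′≢k) jl j′l′)

    module Space {N} (Y : Fin N → Matrix n) (2<N : 2 < N)
                 (flat : ∀ x → Flat P (combination Y x))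
                 (independent : ∀ x → combination Y x ≋ O → ∀ p → x p ≈ 0#) where

      -- On a 2 × 2 block the flat matrices form a nondegenerate quadric in K⁴,
      -- which contains no 3-dimensional subspace.
      no-block : ∀ z → Block (combination Y z) → ¬ (∀ i j → combination Y z i j ≈ 0# → ∀ p → Y p i j ≈ 0#)
      no-block z B z-generic =
        -- Three dimensions leave room for two linear conditions: `U` vanishes on row `i` of the
        -- block and `V` on column `k`. Polarising the quadric against `Z` shows that `U j k` and
        -- `V i l` are nonzero, yet the quadric at U + V is `β` times their product.
        dependent 2<N (λ p → λ { zero → Y p i k ; (suc _) → Y p i l }) λ (u , (p , u≉0) , u-eqs) →
        dependent 2<N (λ p → λ { zero → Y p i k ; (suc _) → Y p j k }) λ (v , (p′ , v≉0) , v-eqs) →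
        let U = combination Y u
            V = combination Y v
            Uik = u-eqs 0F
            Uil = u-eqs 1F
            Vik = v-eqs 0F
            Vjk = v-eqs 1F
            Ujk≉0 : ¬ U j k ≈ 0#
            Ujk≉0 Ujk = vanishing u Uik Uil Ujk (cancel-zero (*-≉0 α≉0 ik≉0) (begin
              α * Z i k * U j l                                              ≈⟨ +-identityʳ _ ⟨
              α * Z i k * U j l + 0#                                         ≈⟨ +-congˡ (trans (*-congˡ Ujk) (zeroʳ _)) ⟨
              α * Z i k * U j l + β * Z i l * U j k                          ≈⟨ polar (Z i k) (Z i l) (Z j k) (Z j l) (U j k) (U j l)
                                                                                  (Q z) (trans (+-cong (*-congˡ (*-congʳ (+-zeroʳ Uik))) (*-congˡ (*-congʳ (+-zeroʳ Uil)))) (Q-+ z u)) ⟩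
              0# ∎)) p u≉0
            Vil≉0 : ¬ V i l ≈ 0#
            Vil≉0 Vil = vanishing v Vik Vil Vjk (cancel-zero (*-≉0 α≉0 ik≉0) (begin
              α * Z i k * V j l                                              ≈⟨ +-identityʳ _ ⟨
              α * Z i k * V j l + 0#                                         ≈⟨ +-congˡ (trans (*-congˡ Vil) (zeroʳ _)) ⟨
              α * Z i k * V j l + β * Z j k * V i l                          ≈⟨ polar (Z i k) (Z j k) (Z i l) (Z j l) (V i l) (V j l)
                                                                                  (trans (+-congˡ (*-congˡ (*-comm _ _))) (Q z))
                                                                                  (trans (+-cong (*-congˡ (*-congʳ (+-zeroʳ Vik))) (*-congˡ (trans (*-congʳ (+-zeroʳ Vjk)) (*-comm _ _)))) (Q-+ z v)) ⟩
              0# ∎)) p′ v≉0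
        in *-≉0 β≉0 (*-≉0 Vil≉0 Ujk≉0) (begin
             β * (V i l * U j k)  ≈⟨ +-identityˡ _ ⟨
             0# + β * (V i l * U j k)
               ≈⟨ +-cong (trans (*-congˡ (trans (*-congʳ (trans (+-cong Uik Vik) (+-identityˡ 0#))) (zeroˡ _))) (zeroʳ α))
                         (*-congˡ (*-cong (trans (+-congʳ Uil) (+-identityˡ _)) (trans (+-congˡ Vjk) (+-identityʳ _)))) ⟨
             α * ((U i k + V i k) * (U j l + V j l)) + β * ((U i l + V i l) * (U j k + V j k))  ≈⟨ Q-+ u v ⟩
             0#  ∎)
        where
        open Block B
        Z = combination Y z
        relation = minor-relation i≢j k≢l
        α = proj₁ relation
        β = proj₁ (proj₂ relation)
        α≉0 = proj₁ (proj₂ (proj₂ relation))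
        β≉0 = proj₁ (proj₂ (proj₂ (proj₂ relation)))
        Q : ∀ x → let X = combination Y x in α * (X i k * X j l) + β * (X i l * X j k) ≈ 0#
        Q x = proj₂ (proj₂ (proj₂ (proj₂ relation))) {combination Y x} (flat x)
        Q-+ : ∀ x y → let X = combination Y x ; X′ = combination Y y in
          α * ((X i k + X′ i k) * (X j l + X′ j l)) + β * ((X i l + X′ i l) * (X j k + X′ j k)) ≈ 0#
        Q-+ x y = trans (+-cong (*-congˡ (*-cong (eq i k) (eq j l))) (*-congˡ (*-cong (eq i l) (eq j k)))) (Q (λ p → x p + y p))
          where eq = λ a b → sym (combination-+ Y x y a b)
        +-zeroʳ : ∀ {a b} → b ≈ 0# → a ≈ a + b
        +-zeroʳ b≈0 = trans (sym (+-identityʳ _)) (+-congˡ (sym b≈0))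
        polar : ∀ a b c d c′ d′ → α * (a * d) + β * (b * c) ≈ 0# →
                α * (a * (d + d′)) + β * (b * (c + c′)) ≈ 0# → α * a * d′ + β * b * c′ ≈ 0#
        polar a b c d c′ d′ eq eq′ = begin
          α * a * d′ + β * b * c′                                         ≈⟨ +-identityˡ _ ⟨
          0# + (α * a * d′ + β * b * c′)                                  ≈⟨ +-congʳ eq ⟨
          α * (a * d) + β * (b * c) + (α * a * d′ + β * b * c′)
            ≈⟨ solve 8 (λ α β a b c d c′ d′ → α :* (a :* d) :+ β :* (b :* c) :+ (α :* a :* d′ :+ β :* b :* c′) :=
                          α :* (a :* (d :+ d′)) :+ β :* (b :* (c :+ c′))) refl α β a b c d c′ d′ ⟩
          α * (a * (d + d′)) + β * (b * (c + c′))                         ≈⟨ eq′ ⟩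
          0#                                                              ∎
        vanishing : ∀ x → let X = combination Y x in
          X i k ≈ 0# → X i l ≈ 0# → X j k ≈ 0# → X j l ≈ 0# → ∀ p → ¬ ¬ x p ≈ 0#
        vanishing x ik il jk jl p x≉0 = ¬¬∀ (λ r → ¬¬∀ (λ c → entry r c)) λ zeros → x≉0 (independent x zeros p)
          where
          X = combination Y x
          -- Where the generic member `Z` vanishes, so does the whole space; hence only the four
          -- cells of the block remain.
          outside : ∀ r c → ¬ ¬ Z r c ≈ 0# → ¬ ¬ X r c ≈ 0#
          outside r c z kk = z λ rc → kk (∑-few.sum-ε λ p → trans (*-congˡ (z-generic r c rc p)) (zeroʳ (x p)))
          entry : ∀ r c → ¬ ¬ X r c ≈ 0#
          entry r c with r ≟ i | r ≟ j | c ≟ k | c ≟ l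
          ... | no r≢i | no r≢j | _ | _ = outside r c (row-zero r r≢i r≢j c)
          ... | _ | _ | no c≢k | no c≢l = outside r c (column-zero c c≢k c≢l r)
          ... | yes ≡.refl | _ | yes ≡.refl | _ = λ k → k ik
          ... | yes ≡.refl | _ | _ | yes ≡.refl = λ k → k il
          ... | _ | yes ≡.refl | yes ≡.refl | _ = λ k → k jk
          ... | _ | yes ≡.refl | _ | yes ≡.refl = λ k → k jl

      -- A generic member vanishes only where every member does, so a line supporting it supports
      -- the whole space.
      on-line : ¬ ¬ ∃ λ L → ∀ p → OnLine L (Y p)
      on-line k = generic (λ p c → uncurry (Y p) (remQuot n c)) λ (z , z-generic) →
        let Z = combination Y z
            z-generic′ : ∀ i j → Z i j ≈ 0# → ∀ p → Y p i j ≈ 0#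
            z-generic′ i j = ≡.subst (λ ij → sum (λ p → z p * uncurry (Y p) ij) ≈ 0# → ∀ p → uncurry (Y p) ij ≈ 0#)
                               (remQuot-combine i j) (z-generic (combine i j))
        in ¬¬∀ (λ i → ¬¬∀ λ j → zero? (Z i j)) λ zeros → case support (flat z) zeros of λ where
          (inj₂ B) → no-block z B z-generic′
          (inj₁ ((true  , r) , on)) → k ((true  , r) , λ p i j i≢r → z-generic′ i j (on i j i≢r) p)
          (inj₁ ((false , r) , on)) → k ((false , r) , λ p i j i≢r → z-generic′ j i (on i j i≢r) p)

-- Conversions: invertibility and monomial form.

module Conversion {c ℓ : Level} (R : CommutativeRing c ℓ) (isField : Over.IsField R) (charZero : Over.CharZero R) where
  open Spaces R isField charZero public

  module Linear {n} {φ : Matrix n → Matrix n} (linear : IsLinear φ) where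
    open IsLinear linear

    φ-zero : ∀ {X} → X ≋ O → φ X ≋ O
    φ-zero {X} X≋O i j = begin
      φ X i j                      ≈⟨ cong X (λ k l → 0# * X k l) (λ k l → trans (X≋O k l) (sym (zeroˡ _))) i j ⟩
      φ (λ k l → 0# * X k l) i j   ≈⟨ homogeneous 0# X i j ⟩
      0# * φ X i j                 ≈⟨ zeroˡ _ ⟩
      0#                           ∎

    φ-combination : ∀ {N} (Y : Fin N → Matrix n) x → φ (combination Y x) ≋ combination (φ ∘ Y) x
    φ-combination {zero}  Y x i j = φ-zero (λ _ _ → refl) i j
    φ-combination {suc N} Y x i j = begin
      φ (combination Y x) i j   ≈⟨ additive (λ k l → x zero * Y zero k l) (combination (Y ∘ suc) (x ∘ suc)) i j ⟩
      _                         ≈⟨ +-cong (homogeneous (x zero) (Y zero) i j) (φ-combination (Y ∘ suc) (x ∘ suc) i j) ⟩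
      combination (φ ∘ Y) x i j ∎

    module _ (injective : ∀ Y → φ Y ≋ O → Y ≋ O) where
      private
        unit : Fin (n ℕ.* n) → Matrix n
        unit p k l = δ p (combine k l)

        unit-combination : ∀ x k l → combination unit x k l ≈ x (combine k l)
        unit-combination x k l = trans
          (∑-few.sum-single (combine k l) λ p p≢ → trans (*-congˡ (δ-≢ p≢)) (zeroʳ (x p)))
          (trans (*-congˡ (δ-refl (combine k l))) (*-identityʳ _))

        at : Matrix n → Fin (n ℕ.* n) → K
        at X p = uncurry X (remQuot n p)

        at-combine : ∀ X k l → at X (combine k l) ≡ X k l
        at-combine X k l = ≡.cong (uncurry X) (remQuot-combine k l)

      -- The matrix `X` and the images of the n² matrix units are too many to be independent.
      -- Injectivity makes the coefficient of `X` nonzero, and dividing by it exhibits a preimage.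
      surjective : ∀ X → ¬ ¬ ∃ λ Y → φ Y ≋ X
      surjective X k = dependent ℕₚ.≤-refl vectors λ (x , (p , xp≉0) , eqs) → zero? (x zero) λ where
          (yes x₀≈0) → xp≉0 (all-zero x x₀≈0 eqs p)
          (no x₀≉0)  → case inverse (x zero) x₀≉0 of λ (y , x₀y≈1) →
            k (combination unit (λ p → - y * x (suc p)) , solved x y x₀y≈1 eqs)
        where
        vectors : Fin (suc (n ℕ.* n)) → Fin (n ℕ.* n) → K
        vectors zero    = at X
        vectors (suc p) = at (φ (unit p))

        relation : ∀ x → (∀ j → sum (λ i → x i * vectors i j) ≈ 0#) →
                   ∀ k l → x zero * X k l + combination (φ ∘ unit) (x ∘ suc) k l ≈ 0#
        relation x eqs k l = trans (sym (+-cong (*-congˡ (reflexive (at-combine X k l)))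
          (sum-cong-≋ λ p → *-congˡ (reflexive (at-combine (φ (unit p)) k l))))) (eqs (combine k l))

        all-zero : ∀ x → x zero ≈ 0# → (∀ j → sum (λ i → x i * vectors i j) ≈ 0#) → ∀ p → x p ≈ 0#
        all-zero x x₀≈0 eqs zero    = x₀≈0
        all-zero x x₀≈0 eqs (suc p) = begin
          x (suc p)                            ≈⟨ reflexive (≡.cong (x ∘ suc) (combine-remQuot {n} n p)) ⟨
          x (suc (combine (proj₁ (remQuot {n} n p)) (proj₂ (remQuot {n} n p)))) ≈⟨ unit-combination (x ∘ suc) _ _ ⟨
          combination unit (x ∘ suc) _ _       ≈⟨ injective (combination unit (x ∘ suc)) kernel _ _ ⟩
          0#                                   ∎
          where
          kernel : φ (combination unit (x ∘ suc)) ≋ O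
          kernel k l = begin
            φ (combination unit (x ∘ suc)) k l         ≈⟨ φ-combination unit (x ∘ suc) k l ⟩
            combination (φ ∘ unit) (x ∘ suc) k l       ≈⟨ +-identityˡ _ ⟨
            0# + combination (φ ∘ unit) (x ∘ suc) k l  ≈⟨ +-congʳ (trans (*-congʳ x₀≈0) (zeroˡ (X k l))) ⟨
            _                                          ≈⟨ relation x eqs k l ⟩
            0#                                         ∎

        solved : ∀ x y → x zero * y ≈ 1# → (∀ j → sum (λ i → x i * vectors i j) ≈ 0#) →
                 φ (combination unit (λ p → - y * x (suc p))) ≋ X
        solved x y x₀y≈1 eqs k l = begin
          φ (combination unit (λ p → - y * x (suc p))) k l        ≈⟨ φ-combination unit _ k l ⟩
          combination (φ ∘ unit) (λ p → - y * x (suc p)) k l      ≈⟨ sum-cong-≋ (λ p → *-assoc (- y) (x (suc p)) (φ (unit p) k l)) ⟩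
          sum (λ p → - y * (x (suc p) * φ (unit p) k l))          ≈⟨ *-distribˡ-sum (- y) (λ p → x (suc p) * φ (unit p) k l) ⟨
          - y * S                                                 ≈⟨ +-identityʳ _ ⟨
          - y * S + 0#                                            ≈⟨ +-congˡ (trans (*-congˡ (relation x eqs k l)) (zeroʳ y)) ⟨
          - y * S + y * (x zero * X k l + S)
            ≈⟨ solve 5 (λ m y x X S → m :* S :+ y :* (x :* X :+ S) := (m :+ y) :* S :+ x :* y :* X) refl (- y) y (x zero) (X k l) S ⟩
          (- y + y) * S + x zero * y * X k l                      ≈⟨ +-cong (trans (*-congʳ (-‿inverseˡ y)) (zeroˡ S)) (trans (*-congʳ x₀y≈1) (*-identityˡ _)) ⟩
          0# + X k l                                              ≈⟨ +-identityˡ _ ⟩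
          X k l                                                   ∎
          where S = combination (φ ∘ unit) (x ∘ suc) k l

  E : ∀ {n} → Fin n → Fin n → Matrix n
  E i j k l = δ i k * δ j l

  E-diagonal : ∀ {n} (i j : Fin n) → E i j i j ≈ 1#
  E-diagonal i j = trans (*-cong (δ-refl i) (δ-refl j)) (*-identityˡ 1#)

  E-row : ∀ {n} {i k : Fin n} j l → i ≢ k → E i j k l ≈ 0#
  E-row j l i≢k = trans (*-congʳ (δ-≢ i≢k)) (zeroˡ _)

  orient-≋ : ∀ {n} b {X Y : Matrix n} → X ≋ Y → orient b X ≋ orient b Y
  orient-≋ true  X≋Y i j = X≋Y i j
  orient-≋ false X≋Y i j = X≋Y j i

  module _ (q s : K) (q≉0 : ¬ q ≈ 0#) (s≉0 : ¬ s ≈ 0#) (1+q≉0 : ¬ 1# + q ≈ 0#) {m : ℕ} where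
    open FlatMatrices q q≉0 1+q≉0 {m}
    module Pq = QPermanent q {n}
    module Ps = QPermanent s {n}

    module _ {φ : Matrix n → Matrix n} (linear : IsLinear φ) (converts : ∀ X → Pq.P X ≈ Ps.P (φ X)) where
      open IsLinear linear
      open Linear linear

      -- Translation by a kernel element leaves P_q unchanged. Each cell `k`, `l` lies on some
      -- permutation, so `invariant⇒zero` clears it; `b` is any other row.
      φ-injective : ∀ Y → φ Y ≋ O → Y ≋ O
      φ-injective Y φY≋O k l = case third k k of λ (b , b≢k , _) → case redirect {σ = id} id k l of λ where
          (σ , inj , ≡.refl , _) → invariant⇒zero q q≉0 (≡.≢-sym b≢k) inj {Y} invariant
        where
        invariant : ∀ B → Pq.P (B ⊕ Y) ≈ Pq.P B
        invariant B = begin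
          Pq.P (B ⊕ Y)        ≈⟨ converts (B ⊕ Y) ⟩
          Ps.P (φ (B ⊕ Y))    ≈⟨ Ps.P-cong (λ i j → trans (additive B Y i j) (trans (+-congˡ (φY≋O i j)) (+-identityʳ _))) ⟩
          Ps.P (φ B)          ≈⟨ converts B ⟨
          Pq.P B              ∎

      flat-pullback : ∀ {Y} → Flat Ps.P (φ Y) → Flat Pq.P Y
      flat-pullback {Y} flat B = begin
        Pq.P (B ⊕ (Y ⊕ Y)) + Pq.P (B ⊕ O)  ≈⟨ +-cong (push λ i j → trans (additive B (Y ⊕ Y) i j) (+-congˡ (additive Y Y i j)))
                                                     (push λ i j → trans (additive B O i j) (+-congˡ (φ-zero (λ _ _ → refl) i j))) ⟩
        Ps.P (φ B ⊕ (φ Y ⊕ φ Y)) + Ps.P (φ B ⊕ O)  ≈⟨ flat (φ B) ⟩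
        Ps.P (φ B ⊕ φ Y) + Ps.P (φ B ⊕ φ Y)        ≈⟨ +-cong (push (additive B Y)) (push (additive B Y)) ⟨
        Pq.P (B ⊕ Y) + Pq.P (B ⊕ Y)        ∎
        where
        push : ∀ {X Z} → φ X ≋ Z → Pq.P X ≈ Ps.P Z
        push {X} eq = trans (converts X) (Ps.P-cong eq)

      module Preimages (Ψ : Fin n → Fin n → Matrix n) (φΨ : ∀ i j → φ (Ψ i j) ≋ E i j) where

        -- For fixed `b` and `i` these are the preimages of the matrix units on row `i` or, for `b`
        -- false, on column `i`.
        Ψ̂ : Bool → Fin n → Fin n → Matrix n
        Ψ̂ b = orient b Ψ

        φΨ̂ : ∀ b i j → orient b (φ (Ψ̂ b i j)) ≋ E i j
        φΨ̂ true  i j k l = φΨ i j k l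
        φΨ̂ false i j k l = trans (φΨ j i l k) (*-comm _ _)

        module _ (b : Bool) {N : ℕ} (i j : Fin N → Fin n) where
          family : Fin N → Matrix n
          family p = Ψ̂ b (i p) (j p)

          family-image : ∀ x → orient b (φ (combination family x)) ≋ combination (λ p → E (i p) (j p)) x
          family-image x k l = trans (orient-≋ b (φ-combination family x) k l) (image b x k l)
            where
            image : ∀ b x k l → orient b (combination (λ p → φ (Ψ̂ b (i p) (j p))) x) k l ≈ combination (λ p → E (i p) (j p)) x k l
            image true  x k l = sum-cong-≋ λ p → *-congˡ (φΨ̂ true (i p) (j p) k l)
            image false x k l = sum-cong-≋ λ p → *-congˡ (φΨ̂ false (i p) (j p) k l)

          -- φ turns the combination into one of distinct matrix units, from which the coefficients
          -- are read off.
          independent : (∀ {p p′} → i p ≡ i p′ → j p ≡ j p′ → p ≡ p′) →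
                        ∀ x → combination family x ≋ O → ∀ p → x p ≈ 0#
          independent distinct x zeros p = begin
            x p                                                          ≈⟨ *-identityʳ _ ⟨
            x p * 1#                                                     ≈⟨ *-congˡ (E-diagonal (i p) (j p)) ⟨
            x p * E (i p) (j p) (i p) (j p)                              ≈⟨ ∑-few.sum-single p others ⟨
            combination (λ p → E (i p) (j p)) x (i p) (j p)              ≈⟨ family-image x (i p) (j p) ⟨
            orient b (φ (combination family x)) (i p) (j p)              ≈⟨ zero-image b (i p) (j p) ⟩
            0#                                                           ∎
            where
            zero-image : ∀ b → orient b (φ (combination family x)) ≋ O
            zero-image true  k l = φ-zero zeros k l
            zero-image false k l = φ-zero zeros l k
            others : ∀ p′ → p′ ≢ p → x p′ * E (i p′) (j p′) (i p) (j p) ≈ 0#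
            others p′ p′≢p = trans (*-congˡ off) (zeroʳ (x p′))
              where
              off : E (i p′) (j p′) (i p) (j p) ≈ 0#
              off with i p′ ≟ i p | j p′ ≟ j p
              ... | no i≢ | _ = zeroˡ _
              ... | yes _ | no j≢ = zeroʳ _
              ... | yes i≡ | yes j≡ = contradiction (distinct i≡ j≡) p′≢p

        line-flat : ∀ b i x → Flat Pq.P (combination (family b (λ (_ : Fin n) → i) id) x)
        line-flat b i x = flat-pullback (Ps.flat-line (thin b (family-image b (λ _ → i) id x)))
          where
          onRow : ∀ k l → i ≢ k → combination (λ j → E i j) x k l ≈ 0#
          onRow k l i≢k = ∑-few.sum-ε λ j → trans (*-congˡ (E-row j l i≢k)) (zeroʳ (x j))
          thin : ∀ b {X} → orient b X ≋ combination (λ j → E i j) x → ∀ σ → Inj σ → ∃ λ a → ∀ k → k ≢ a → X k (σ k) ≈ 0#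
          thin true  eq σ inj = i , λ k k≢i → trans (eq k (σ k)) (onRow k (σ k) (≡.≢-sym k≢i))
          thin false eq σ inj = case injective⇒surjective inj i of λ (a , σa≡i) →
            a , λ k k≢a → trans (eq (σ k) k) (onRow (σ k) k λ i≡σk → k≢a (inj (≡.trans (≡.sym i≡σk) (≡.sym σa≡i))))

        -- The preimages of the units on one line span a flat space of dimension n, and n ≥ 3 is
        -- what `Space` asks for.
        line-image : ∀ b i → ¬ ¬ ∃ λ L → ∀ j → OnLine L (Ψ̂ b i j)
        line-image b i = Space.on-line (family b (λ _ → i) id) (s≤s (s≤s (s≤s z≤n))) (line-flat b i)
          (independent b (λ _ → i) id λ _ eq → eq)

        Ψ-nonzero : ∀ b i j → ¬ Ψ̂ b i j ≋ O
        Ψ-nonzero b i j zeros = proj₁ isField (independent b {1} (λ _ → i) (λ _ → j) (λ { {0F} {0F} _ _ → ≡.refl }) (λ _ → 1#)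
          (λ k l → trans (+-identityʳ _) (trans (*-identityˡ _) (zeros k l))) 0F)

        -- The line L carries n independent matrices already.
        overfull : ∀ {b i i′ j′ L} → (∀ j → OnLine L (Ψ̂ b i j)) → i′ ≢ i → ¬ OnLine L (Ψ̂ b i′ j′)
        overfull {b} {i} {i′} {j′} {L = β , r} on i′≢i on′ =
          dependent ℕₚ.≤-refl (λ p l → orient β (member p) r l) λ (x , (p , xp≉0) , eqs) →
            xp≉0 (independent b rows columns distinct x (vanish β x eqs (λ p → on-line′ p)) p)
          where
          rows columns : Fin (suc n) → Fin n
          rows zero    = i′
          rows (suc _) = i
          columns zero    = j′
          columns (suc j) = j
          member : Fin (suc n) → Matrix n
          member = family b rows columns
          distinct : ∀ {p p′} → rows p ≡ rows p′ → columns p ≡ columns p′ → p ≡ p′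
          distinct {zero}  {zero}   _  _  = ≡.refl
          distinct {zero}  {suc _}  eq _  = contradiction eq i′≢i
          distinct {suc _} {zero}   eq _  = contradiction (≡.sym eq) i′≢i
          distinct {suc _} {suc _}  _  eq = ≡.cong suc eq
          on-line′ : ∀ p → OnLine (β , r) (member p)
          on-line′ zero    = on′
          on-line′ (suc j) = on j
          vanish : ∀ β x → (∀ l → sum (λ p → x p * orient β (member p) r l) ≈ 0#) →
                   (∀ p → OnLine (β , r) (member p)) → combination member x ≋ O
          vanish true  x eqs on k l with k ≟ r
          ... | yes ≡.refl = eqs l
          ... | no k≢r = ∑-few.sum-ε λ p → trans (*-congˡ (on p k l k≢r)) (zeroʳ (x p))
          vanish false x eqs on k l with l ≟ r
          ... | yes ≡.refl = eqs k
          ... | no l≢r = ∑-few.sum-ε λ p → trans (*-congˡ (on p l k l≢r)) (zeroʳ (x p))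

        -- Up to transposition, `Ψ i j` is a multiple of the matrix unit at `ρ i`, `τ j`; the
        -- multiples are left free.
        record Monomial : Set (c ⊔ ℓ) where
          field
            β   : Bool
            ρ τ : Fin n → Fin n
            ρ-injective : Inj ρ
            τ-injective : Inj τ
            entry-zero : ∀ i j k l → k ≢ ρ i ⊎ l ≢ τ j → orient β (Ψ i j) k l ≈ 0#

        -- A row and a column share a cell, so parallel images would be equal, hence overfull;
        -- therefore all rows have parallel images and all columns perpendicular ones.
        monomial : (∀ b i → ∃ λ L → ∀ j → OnLine L (Ψ̂ b i j)) → Monomial
        monomial Λ = record
          { β = β ; ρ = ρ ; τ = τ
          ; ρ-injective = λ {i} {i′} → injective true i i′ (≡.trans (rows-β i) (≡.sym (rows-β i′)))
          ; τ-injective = λ {j} {j′} → injective false j j′ (≡.trans (columns-β j) (≡.sym (columns-β j′)))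
          ; entry-zero = λ i j k l → λ where
              (inj₁ k≢) → on-row (rows-β i) (proj₂ (Λ true i) j) k l k≢
              (inj₂ l≢) → on-column (columns-β j) (proj₂ (Λ false j) i) k l l≢
          }
          where
          bit-of : Bool → Fin n → Bool
          bit-of b i = proj₁ (proj₁ (Λ b i))
          index-of : Bool → Fin n → Fin n
          index-of b i = proj₂ (proj₁ (Λ b i))
          β = bit-of true 0F
          ρ = index-of true
          τ = index-of false

          injective : ∀ b i i′ → bit-of b i ≡ bit-of b i′ → index-of b i ≡ index-of b i′ → i ≡ i′
          injective b i i′ β≡ r≡ = decidable-stable (i ≟ i′) λ i≢i′ →
            overfull {b} {i} {i′} {0F} {proj₁ (Λ b i)} (proj₂ (Λ b i)) (≡.≢-sym i≢i′)
              (≡.subst₂ (λ β r → OnLine (β , r) (Ψ̂ b i′ 0F)) (≡.sym β≡) (≡.sym r≡) (proj₂ (Λ b i′) 0F))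

          perpendicular : ∀ i j → bit-of true i ≢ bit-of false j
          -- If the images of row `i` and column `j` were distinct parallel lines, `Ψ i j` would lie
          -- on both and vanish. If they were the same line, it would carry all of row `i` and a
          -- further member of column `j`.
          perpendicular i j eq with index-of true i ≟ index-of false j
          ... | no r≢r′ = Ψ-nonzero true i j (parallel (bit-of true i) (proj₂ (Λ true i) j)
                            (≡.subst (λ β → OnLine (β , index-of false j) (Ψ i j)) (≡.sym eq) (proj₂ (Λ false j) i)))
            where
            rowwise : ∀ β {X} → OnLine (β , index-of true i) X → OnLine (β , index-of false j) X → orient β X ≋ O
            rowwise β on on′ k l with k ≟ index-of true i
            ... | no k≢r     = on k l k≢r
            ... | yes ≡.refl = on′ k l r≢r′
            parallel : ∀ β {X} → OnLine (β , index-of true i) X → OnLine (β , index-of false j) X → X ≋ O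
            parallel true  on on′ = rowwise true on on′
            parallel false on on′ k l = rowwise false on on′ l k
          ... | yes r≡r′ = case third i i of λ (i′ , i′≢i , _) →
            overfull {true} {i} {i′} {j} {proj₁ (Λ true i)} (proj₂ (Λ true i)) i′≢i
              (≡.subst₂ (λ β r → OnLine (β , r) (Ψ i′ j)) (≡.sym eq) (≡.sym r≡r′) (proj₂ (Λ false j) i′))

          columns-β : ∀ j → bit-of false j ≡ not β
          columns-β j = other (perpendicular 0F j)
            where
            other : ∀ {a b} → a ≢ b → b ≡ not a
            other {true}  {true}  ne = contradiction ≡.refl ne
            other {true}  {false} ne = ≡.refl
            other {false} {true}  ne = ≡.refl
            other {false} {false} ne = contradiction ≡.refl ne

          rows-β : ∀ i → bit-of true i ≡ β
          rows-β i = same (≡.subst (bit-of true i ≢_) (columns-β 0F) (perpendicular i 0F))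
            where
            same : ∀ {a b} → a ≢ not b → a ≡ b
            same {true}  {true}  ne = ≡.refl
            same {true}  {false} ne = contradiction ≡.refl ne
            same {false} {true}  ne = contradiction ≡.refl ne
            same {false} {false} ne = ≡.refl

          on-row : ∀ {β′ r X} → β′ ≡ β → OnLine (β′ , r) X → ∀ k l → k ≢ r → orient β X k l ≈ 0#
          on-row ≡.refl on = on

          on-column : ∀ {β′ r X} → β′ ≡ not β → OnLine (β′ , r) X → ∀ k l → l ≢ r → orient β X k l ≈ 0#
          on-column {X = X} β′≡ on k l l≢r = turn β (≡.subst (λ b → OnLine (b , _) X) β′≡ on)
            where
            turn : ∀ β → OnLine (not β , _) X → orient β X k l ≈ 0#
            turn true  on = on l k l≢r
            turn false on = on l k l≢r

        -- Comparison of the weights of both forms.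

        module _ (s²≈1 : s * s ≈ 1#) (q≉s : ¬ q ≈ s) (M : Monomial) where
          open Monomial M
          open Hexagonal q q≉0 {n} using () renaming (hexagon-weights to hexagon-q)
          open Hexagonal s s≉0 {n} using () renaming (hexagon-weights to hexagon-s)

          inverse-of : ∀ {f : Fin n → Fin n} → Inj f → ∃ λ g → (∀ k → f (g k) ≡ k) × (∀ i → g (f i) ≡ i)
          inverse-of inj = (λ k → proj₁ (onto k)) , (λ k → proj₂ (onto k)) , λ i → inj (proj₂ (onto _))
            where onto = injective⇒surjective inj

          ρ⁻¹ τ⁻¹ : Fin n → Fin n
          ρ⁻¹ = proj₁ (inverse-of ρ-injective)
          τ⁻¹ = proj₁ (inverse-of τ-injective)
          ρρ⁻¹ : ∀ k → ρ (ρ⁻¹ k) ≡ k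
          ρρ⁻¹ = proj₁ (proj₂ (inverse-of ρ-injective))
          ρ⁻¹ρ : ∀ i → ρ⁻¹ (ρ i) ≡ i
          ρ⁻¹ρ = proj₂ (proj₂ (inverse-of ρ-injective))
          ττ⁻¹ : ∀ k → τ (τ⁻¹ k) ≡ k
          ττ⁻¹ = proj₁ (proj₂ (inverse-of τ-injective))

          τ⁻¹-injective : Inj τ⁻¹
          τ⁻¹-injective eq = ≡.trans (≡.sym (ττ⁻¹ _)) (≡.trans (≡.cong τ eq) (ττ⁻¹ _))

          -- The scalars of the monomial map: the entry at `k`, `l` of the preimage supported there.
          scale : Fin n → Fin n → K
          scale k l = orient β (Ψ (ρ⁻¹ k) (τ⁻¹ l)) k l

          conjugate : (Fin n → Fin n) → Fin n → Fin n
          conjugate κ = τ⁻¹ ∘ κ ∘ ρ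

          -- φ maps it to the permutation matrix of `conjugate κ`, and up to transposition it is
          -- itself a rescaled permutation matrix of `κ`.
          preimage : (Fin n → Fin n) → Matrix n
          preimage κ = combination (family true id (conjugate κ)) (λ _ → 1#)

          preimage-value : ∀ {κ} → Inj κ → Pq.P (preimage κ) ≈ Ps.weight (conjugate κ)
          preimage-value {κ} inj = begin
            Pq.P (preimage κ)             ≈⟨ converts (preimage κ) ⟩
            Ps.P (φ (preimage κ))         ≈⟨ Ps.P-monomial (conjugate κ) (λ i j j≢ → trans (image i j) (E-sum-zero i j j≢)) ⟩
            Ps.weight (conjugate κ) * _   ≈⟨ *-congˡ (∏-few.sum-ε λ i → trans (image i (conjugate κ i)) (E-sum-one i)) ⟩
            Ps.weight (conjugate κ) * 1#  ≈⟨ *-identityʳ _ ⟩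
            Ps.weight (conjugate κ)       ∎
            where
            image : φ (preimage κ) ≋ combination (λ i → E i (conjugate κ i)) (λ _ → 1#)
            image = family-image true id (conjugate κ) (λ _ → 1#)
            term : ∀ i j → combination (λ i → E i (conjugate κ i)) (λ _ → 1#) i j ≈ 1# * E i (conjugate κ i) i j
            term i j = ∑-few.sum-single i {λ i′ → 1# * E i′ (conjugate κ i′) i j} λ i′ i′≢i →
              trans (*-congˡ (E-row (conjugate κ i′) j i′≢i)) (zeroʳ 1#)
            E-sum-zero : ∀ i j → j ≢ conjugate κ i → combination (λ i → E i (conjugate κ i)) (λ _ → 1#) i j ≈ 0#
            E-sum-zero i j j≢ = trans (term i j) (trans (*-congˡ (trans (*-congˡ (δ-≢ (≡.≢-sym j≢))) (zeroʳ _))) (zeroʳ 1#))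
            E-sum-one : ∀ i → combination (λ i → E i (conjugate κ i)) (λ _ → 1#) i (conjugate κ i) ≈ 1#
            E-sum-one i = trans (term i _) (trans (*-identityˡ _) (E-diagonal i (conjugate κ i)))

          oriented-entry : ∀ κ k l → orient β (preimage κ) k l ≈ orient β (Ψ (ρ⁻¹ k) (τ⁻¹ (κ k))) k l
          oriented-entry κ k l = begin
            orient β (preimage κ) k l  ≈⟨ inside β ⟩
            sum (λ i → 1# * orient β (Ψ i (conjugate κ i)) k l)  ≈⟨ ∑-few.sum-single (ρ⁻¹ k) others ⟩
            1# * orient β (Ψ (ρ⁻¹ k) (conjugate κ (ρ⁻¹ k))) k l  ≈⟨ *-identityˡ _ ⟩
            _  ≈⟨ reflexive (≡.cong (λ t → orient β (Ψ (ρ⁻¹ k) (τ⁻¹ (κ t))) k l) (ρρ⁻¹ k)) ⟩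
            orient β (Ψ (ρ⁻¹ k) (τ⁻¹ (κ k))) k l  ∎
            where
            inside : ∀ β → orient β (preimage κ) k l ≈ sum (λ i → 1# * orient β (Ψ i (conjugate κ i)) k l)
            inside true  = refl
            inside false = refl
            others : ∀ i → i ≢ ρ⁻¹ k → 1# * orient β (Ψ i (conjugate κ i)) k l ≈ 0#
            others i i≢ = trans (*-congˡ (entry-zero i (conjugate κ i) k l (inj₁ λ k≡ρi → i≢ (≡.trans (≡.sym (ρ⁻¹ρ i)) (≡.cong ρ⁻¹ (≡.sym k≡ρi)))))) (zeroʳ 1#)

          off-entry : ∀ κ k l → l ≢ κ k → orient β (preimage κ) k l ≈ 0#
          off-entry κ k l l≢ = trans (oriented-entry κ k l) (entry-zero _ _ k l (inj₂ λ l≡ → l≢ (≡.trans l≡ (ττ⁻¹ (κ k)))))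

          on-entry : ∀ κ k l → l ≡ κ k → orient β (preimage κ) k l ≈ scale k l
          on-entry κ k l ≡.refl = oriented-entry κ k l

          product : (Fin n → Fin n) → K
          product κ = prod (λ i → orient β scale i (κ i))

          -- Transposing the permutation matrix of `κ` gives that of its inverse.
          choose : Bool → (κ κ⁻¹ : Fin n → Fin n) → Fin n → Fin n
          choose true  κ κ⁻¹ = κ
          choose false κ κ⁻¹ = κ⁻¹

          -- Both sides of P_q = P_s ∘ φ at `preimage κ` reduce to a single term.
          weight-relation : ∀ {κ κ⁻¹} → Inj κ → (∀ i → κ (κ⁻¹ i) ≡ i) → (∀ i → κ⁻¹ (κ i) ≡ i) →
            Pq.weight (choose β κ κ⁻¹) * product (choose β κ κ⁻¹) ≈ Ps.weight (conjugate κ)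
          weight-relation {κ} {κ⁻¹} inj κκ⁻¹ κ⁻¹κ = trans (sym (value β (off-entry κ) (on-entry κ))) (preimage-value inj)
            where
            value : ∀ β → (∀ k l → l ≢ κ k → orient β (preimage κ) k l ≈ 0#) →
                    (∀ k l → l ≡ κ k → orient β (preimage κ) k l ≈ scale k l) →
                    Pq.P (preimage κ) ≈ Pq.weight (choose β κ κ⁻¹) * prod (λ i → orient β scale i (choose β κ κ⁻¹ i))
            value true off on = trans (Pq.P-monomial κ off) (*-congˡ (∏Sum.sum-cong-≋ λ i → on i (κ i) ≡.refl))
            value false off on = trans
              (Pq.P-monomial κ⁻¹ λ i j j≢ → off j i λ i≡κj → j≢ (≡.trans (≡.sym (κ⁻¹κ j)) (≡.cong κ⁻¹ (≡.sym i≡κj))))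
              (*-congˡ (∏Sum.sum-cong-≋ λ i → on (κ⁻¹ i) i (≡.sym (κκ⁻¹ i))))

          shuffle : (x y z : Fin n) → Fin n → Fin n
          shuffle x y z 0F = x
          shuffle x y z 1F = y
          shuffle x y z 2F = z
          shuffle x y z (suc (suc (suc i))) = suc (suc (suc i))

          -- Each parity is closed under inverses: `e₁` and `e₂` are mutually inverse and the other
          -- four are involutions. A transposition in φ therefore only exchanges `e₁` with `e₂`.
          e₀ e₁ e₂ o₀ o₁ o₂ : Fin n → Fin n
          e₀ = shuffle 0F 1F 2F
          e₁ = shuffle 1F 2F 0F
          e₂ = shuffle 2F 0F 1F
          o₀ = shuffle 1F 0F 2F
          o₁ = shuffle 0F 2F 1F
          o₂ = shuffle 2F 1F 0F

          each : ∀ {f : Fin n → Fin n} → f 0F ≡ 0F → f 1F ≡ 1F → f 2F ≡ 2F →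
                 (∀ i → f (suc (suc (suc i))) ≡ suc (suc (suc i))) → ∀ i → f i ≡ i
          each p q r s 0F = p
          each p q r s 1F = q
          each p q r s 2F = r
          each p q r s (suc (suc (suc i))) = s i

          e₀e₀ = each {e₀ ∘ e₀} ≡.refl ≡.refl ≡.refl λ _ → ≡.refl
          e₁e₂ = each {e₁ ∘ e₂} ≡.refl ≡.refl ≡.refl λ _ → ≡.refl
          e₂e₁ = each {e₂ ∘ e₁} ≡.refl ≡.refl ≡.refl λ _ → ≡.refl
          o₀o₀ = each {o₀ ∘ o₀} ≡.refl ≡.refl ≡.refl λ _ → ≡.refl
          o₁o₁ = each {o₁ ∘ o₁} ≡.refl ≡.refl ≡.refl λ _ → ≡.refl
          o₂o₂ = each {o₂ ∘ o₂} ≡.refl ≡.refl ≡.refl λ _ → ≡.refl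

          cancelled : ∀ {f g : Fin n → Fin n} → (∀ i → g (f i) ≡ i) → Inj f
          cancelled {g = g} gf eq = ≡.trans (≡.sym (gf _)) (≡.trans (≡.cong g eq) (gf _))

          standard : Hexagon 0F 1F 2F 0F 1F 2F e₀ e₁ e₂ o₀ o₁ o₂
          standard = record
            { a≢b = λ () ; a≢c = λ () ; b≢c = λ () ; x≢y = λ () ; x≢z = λ () ; y≢z = λ ()
            ; E₀ = shuffled ; E₁ = shuffled ; E₂ = shuffled ; O₀ = shuffled ; O₁ = shuffled ; O₂ = shuffled }
            where
            shuffled : ∀ {x y z} → Rearranges e₀ 0F 1F 2F x y z (shuffle x y z)
            shuffled = rearranges ≡.refl ≡.refl ≡.refl λ where
              0F s≢0 _ _ → contradiction ≡.refl s≢0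
              1F _ s≢1 _ → contradiction ≡.refl s≢1
              2F _ _ s≢2 → contradiction ≡.refl s≢2
              (suc (suc (suc _))) _ _ _ → ≡.refl

          conjugated : Hexagon (ρ⁻¹ 0F) (ρ⁻¹ 1F) (ρ⁻¹ 2F) (τ⁻¹ 0F) (τ⁻¹ 1F) (τ⁻¹ 2F)
            (conjugate e₀) (conjugate e₁) (conjugate e₂) (conjugate o₀) (conjugate o₁) (conjugate o₂)
          conjugated = record
            { a≢b = ρ⁻¹-≢ (λ ()) ; a≢c = ρ⁻¹-≢ (λ ()) ; b≢c = ρ⁻¹-≢ (λ ())
            ; x≢y = τ⁻¹-≢ (λ ()) ; x≢z = τ⁻¹-≢ (λ ()) ; y≢z = τ⁻¹-≢ (λ ())
            ; E₀ = transported E₀ ; E₁ = transported E₁ ; E₂ = transported E₂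
            ; O₀ = transported O₀ ; O₁ = transported O₁ ; O₂ = transported O₂ }
            where
            open Hexagon standard using (E₀; E₁; E₂; O₀; O₁; O₂)
            ρ⁻¹-≢ : ∀ {k l} → k ≢ l → ρ⁻¹ k ≢ ρ⁻¹ l
            ρ⁻¹-≢ k≢l eq = k≢l (≡.trans (≡.sym (ρρ⁻¹ _)) (≡.trans (≡.cong ρ eq) (ρρ⁻¹ _)))
            τ⁻¹-≢ : ∀ {k l} → k ≢ l → τ⁻¹ k ≢ τ⁻¹ l
            τ⁻¹-≢ k≢l eq = k≢l (τ⁻¹-injective eq)
            transported : ∀ {σ κ a b c x y z} → Rearranges σ a b c x y z κ →
              Rearranges (conjugate σ) (ρ⁻¹ a) (ρ⁻¹ b) (ρ⁻¹ c) (τ⁻¹ x) (τ⁻¹ y) (τ⁻¹ z) (conjugate κ)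
            transported {σ} {κ} (rearranges p q r off) = rearranges (at p) (at q) (at r) λ s s≢a s≢b s≢c →
              ≡.cong τ⁻¹ (off (ρ s) (moved s≢a) (moved s≢b) (moved s≢c))
              where
              at : ∀ {a x} → κ a ≡ x → conjugate κ (ρ⁻¹ a) ≡ τ⁻¹ x
              at eq = ≡.cong τ⁻¹ (≡.trans (≡.cong κ (ρρ⁻¹ _)) eq)
              moved : ∀ {s a} → s ≢ ρ⁻¹ a → ρ s ≢ a
              moved s≢ eq = s≢ (≡.trans (≡.sym (ρ⁻¹ρ _)) (≡.cong ρ⁻¹ eq))

          ie₀ : Inj e₀
          ie₀ = cancelled {g = e₀} e₀e₀
          ie₁ : Inj e₁
          ie₁ = cancelled {g = e₂} e₂e₁
          ie₂ : Inj e₂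
          ie₂ = cancelled {g = e₁} e₁e₂
          io₀ : Inj o₀
          io₀ = cancelled {g = o₀} o₀o₀
          io₁ : Inj o₁
          io₁ = cancelled {g = o₁} o₁o₁
          io₂ : Inj o₂
          io₂ = cancelled {g = o₂} o₂o₂

          conjugate-injective : ∀ {κ} → Inj κ → Inj (conjugate κ)
          conjugate-injective inj eq = ρ-injective (inj (τ⁻¹-injective eq))

          triple-weight : ((Fin n → Fin n) → K) → (κ₀ κ₁ κ₂ : Fin n → Fin n) → K
          triple-weight w κ₀ κ₁ κ₂ = w κ₀ * w κ₁ * w κ₂

          wq ws : (Fin n → Fin n) → K
          wq = Pq.weight
          ws κ = Ps.weight (conjugate κ)

          even-product odd-product Eq Oq Es Os : K
          even-product = triple-weight product e₀ e₁ e₂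
          odd-product  = triple-weight product o₀ o₁ o₂
          Eq = triple-weight wq e₀ e₁ e₂
          Oq = triple-weight wq o₀ o₁ o₂
          Es = triple-weight ws e₀ e₁ e₂
          Os = triple-weight ws o₀ o₁ o₂

          -- Either triple visits each of the nine cells of the leading block once and repeats the
          -- factor of the remaining rows three times. Hence the scalars cancel from the ratio of
          -- even to odd weights.
          products-agree : even-product ≈ odd-product
          products-agree = solve 10 (λ d00 d01 d02 d10 d11 d12 d20 d21 d22 r →
            (d00 :* (d11 :* (d22 :* r))) :* (d01 :* (d12 :* (d20 :* r))) :* (d02 :* (d10 :* (d21 :* r))) :=
            (d01 :* (d10 :* (d22 :* r))) :* (d00 :* (d12 :* (d21 :* r))) :* (d02 :* (d11 :* (d20 :* r))))
            refl (D 0F 0F) (D 0F 1F) (D 0F 2F) (D 1F 0F) (D 1F 1F) (D 1F 2F) (D 2F 0F) (D 2F 1F) (D 2F 2F)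
            (prod (λ i → D (suc (suc (suc i))) (suc (suc (suc i)))))
            where D = orient β scale

          spread : ∀ a b c x y z → a * b * c * (x * y * z) ≈ a * x * (b * y) * (c * z)
          spread = solve 6 (λ a b c x y z → a :* b :* c :* (x :* y :* z) := a :* x :* (b :* y) :* (c :* z)) refl

          even-relation : Eq * even-product ≈ Es
          even-relation = helper β (weight-relation ie₀ e₀e₀ e₀e₀) (weight-relation ie₁ e₁e₂ e₂e₁) (weight-relation ie₂ e₂e₁ e₁e₂)
            where
            helper : ∀ b → wq (choose b e₀ e₀) * product (choose b e₀ e₀) ≈ ws e₀ →
              wq (choose b e₁ e₂) * product (choose b e₁ e₂) ≈ ws e₁ →
              wq (choose b e₂ e₁) * product (choose b e₂ e₁) ≈ ws e₂ → Eq * even-product ≈ Es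
            helper true  r₀ r₁ r₂ = trans (spread _ _ _ _ _ _) (*-cong (*-cong r₀ r₁) r₂)
            helper false r₀ r₁ r₂ = trans (spread _ _ _ _ _ _) (trans
              (solve 3 (λ a b c → a :* b :* c := a :* c :* b) refl _ _ _) (*-cong (*-cong r₀ r₁) r₂))

          odd-relation : Oq * even-product ≈ Os
          odd-relation = trans (*-congˡ products-agree) (trans (spread _ _ _ _ _ _)
            (*-cong (*-cong (involution io₀ o₀o₀) (involution io₁ o₁o₁)) (involution io₂ o₂o₂)))
            where
            helper : ∀ b {κ} {w} → wq (choose b κ κ) * product (choose b κ κ) ≈ w → wq κ * product κ ≈ w
            helper true  eq = eq
            helper false eq = eq
            involution : ∀ {κ} → Inj κ → (∀ i → κ (κ i) ≡ i) → wq κ * product κ ≈ ws κ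
            involution inj κκ = helper β (weight-relation inj κκ κκ)

          Es≉0 : ¬ Es ≈ 0#
          Es≉0 = *-≉0 (*-≉0 (nonzero ie₀) (nonzero ie₁)) (nonzero ie₂)
            where
            nonzero : ∀ {κ} → Inj κ → ¬ ws κ ≈ 0#
            nonzero inj = weight-≉0 s s≉0 (conjugate-injective inj)

          Os≉0 : ¬ Os ≈ 0#
          Os≉0 = *-≉0 (*-≉0 (nonzero io₀) (nonzero io₁)) (nonzero io₂)
            where
            nonzero : ∀ {κ} → Inj κ → ¬ ws κ ≈ 0#
            nonzero inj = weight-≉0 s s≉0 (conjugate-injective inj)

          -- Since `s` is its own inverse, either alternative for the conjugated hexagon implies the
          -- other, whatever `ρ` and `τ` do to the order.
          s-ratio : Es ≈ s * Os × Os ≈ s * Es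
          s-ratio = case hexagon-s conjugated
            ( (conjugate-injective ie₀ , conjugate-injective ie₁ , conjugate-injective ie₂)
            , (conjugate-injective io₀ , conjugate-injective io₁ , conjugate-injective io₂)) of λ where
              (inj₁ eq) → eq , invert eq
              (inj₂ eq) → invert eq , eq
            where
            invert : ∀ {x y} → x ≈ s * y → y ≈ s * x
            invert {x} {y} eq = begin
              y            ≈⟨ *-identityˡ y ⟨
              1# * y       ≈⟨ *-congʳ s²≈1 ⟨
              s * s * y    ≈⟨ *-assoc s s y ⟩
              s * (s * y)  ≈⟨ *-congˡ eq ⟨
              s * x        ∎

          contradictory : ⊥
          contradictory = case hexagon-q standard ((ie₀ , ie₁ , ie₂) , (io₀ , io₁ , io₂)) of λ where
              (inj₁ eq) → compare even-relation odd-relation eq (proj₁ s-ratio) Os≉0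
              (inj₂ eq) → compare odd-relation even-relation eq (proj₂ s-ratio) Es≉0
            where
            compare : ∀ {x y x′ y′ t} → x * t ≈ x′ → y * t ≈ y′ → x ≈ q * y → x′ ≈ s * y′ → ¬ y′ ≈ 0# → ⊥
            compare {x} {y} {x′} {y′} {t} ex ey eq eq′ y′≉0 = q≉s (*-cancel y′≉0 (begin
              y′ * q         ≈⟨ *-comm y′ q ⟩
              q * y′         ≈⟨ *-congˡ ey ⟨
              q * (y * t)    ≈⟨ *-assoc q y t ⟨
              q * y * t      ≈⟨ *-congʳ eq ⟨
              x * t          ≈⟨ ex ⟩
              x′             ≈⟨ eq′ ⟩
              s * y′         ≈⟨ *-comm s y′ ⟩
              y′ * s         ∎))

      -- Toward absurdity all preimages and all line images may be chosen simultaneously.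
      no-conversion : s * s ≈ 1# → ¬ q ≈ s → ⊥
      no-conversion s²≈1 q≉s =
        ¬¬∀ (λ i → ¬¬∀ λ j → surjective φ-injective (E i j)) λ preimages →
        let open Preimages (λ i j → proj₁ (preimages i j)) (λ i j → proj₂ (preimages i j)) in
        ¬¬∀ (λ i → line-image true i) λ rows → ¬¬∀ (λ j → line-image false j) λ columns →
        contradictory s²≈1 q≉s (monomial λ { true → rows ; false → columns })

  ¬conversion : ∀ q s → ¬ q ≈ 0# → ¬ 1# + q ≈ 0# → s * s ≈ 1# → ¬ q ≈ s → ∀ {n} → 3 ≤ n →
    ¬ ∃ λ (φ : Matrix n → Matrix n) → IsLinear φ × (∀ X → qPer q X ≈ qPer s (φ X))
  ¬conversion q s q≉0 1+q≉0 s²≈1 q≉s {suc (suc (suc m))} (s≤s (s≤s (s≤s _))) (φ , linear , converts) =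
    no-conversion q s q≉0 s≉0 1+q≉0 linear
      (λ X → trans (QPermanent.P-def q X) (trans (converts X) (sym (QPermanent.P-def s (φ X))))) s²≈1 q≉s
    where
    s≉0 : ¬ s ≈ 0#
    s≉0 s≈0 = proj₁ isField (trans (sym s²≈1) (trans (*-congʳ s≈0) (zeroˡ s)))

theorem2p1 : ∀ {c ℓ : Level} (𝕂 : ACF₀ c ℓ) (n : ℕ) → 3 ≤ n →
    let open CommutativeRing (ACF₀.ring 𝕂) in
    let open Over (ACF₀.ring 𝕂) in
    ∀ (q : Carrier) → ¬ (q ≈ 0#) → ¬ (q ≈ 1#) → ¬ (q ≈ - 1#) →
      (¬ (∃ λ (φ : Matrix n → Matrix n) → IsLinear φ × (∀ X → qPer q X ≈ det (φ X))))
      × (¬ (∃ λ (φ : Matrix n → Matrix n) → IsLinear φ × (∀ X → qPer q X ≈ per (φ X))))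
theorem2p1 𝕂 n 3≤n q q≉0 q≉1 q≉-1 =
  ¬conversion q (- 1#) q≉0 1+q≉0 [-1]²≈1 q≉-1 3≤n ,
  ¬conversion q 1# q≉0 1+q≉0 (*-identityˡ 1#) q≉1 3≤n
  where
  open ACF₀ 𝕂
  open Conversion ring isField charZero
  1+q≉0 : ¬ 1# + q ≈ 0#
  1+q≉0 eq = q≉-1 (+-cancelˡ 1# _ _ (trans eq (sym (-‿inverseʳ 1#))))
  [-1]²≈1 : - 1# * - 1# ≈ 1#
  [-1]²≈1 = +-cancelˡ (- 1#) _ _ (begin
    - 1# + - 1# * - 1#         ≈⟨ +-congʳ (*-identityʳ (- 1#)) ⟨
    - 1# * 1# + - 1# * - 1#    ≈⟨ distribˡ (- 1#) 1# (- 1#) ⟨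
    - 1# * (1# + - 1#)         ≈⟨ *-congˡ (-‿inverseʳ 1#) ⟩
    - 1# * 0#                  ≈⟨ zeroʳ (- 1#) ⟩
    0#                         ≈⟨ -‿inverseˡ 1# ⟨
    - 1# + 1#                  ∎)
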